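{- Let $D:\mathbb{Q}\to\{0,1\}$ be the Dedekind cut of an irrational $\alpha\in(0,1)$. There is a function-oracle Turing machine $M$ such that, with oracle $D$, $M$ computes the Beatty sequence of $\alpha$, and on input $n$ it runs in time bounded by a polynomial in $\log n$ and makes at most $\lceil\log n\rceil$ oracle calls, each of input size $O(\log n)$.
   Context: The Dedekind cut of $\alpha$ is $D(q)=0$ iff $q<\alpha$ (and $D(q)=1$ iff $q>\alpha$). The Beatty sequence of $\alpha$ is $B:\mathbb{N}^+\to\mathbb{N}$ with $B(n)/n<\alpha<(B(n)+1)/n$. A function-oracle Turing machine is a multi-tape Turing machine with a special query tape and query/answer states: when it enters the query state with word $x$ on the query tape, the query tape content is replaced by $f(x)$ ($f$ the oracle), taking $|f(x)|$ steps; the input size of a query is the length of $x$. Numbers are written in binary, rationals $p/q$ by interleaving the binary representations of $p$ and $q$. -}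

module Defs where

open import Data.Bool using (Bool; true; false; if_then_else_)
open import Data.Nat using (ℕ; zero; suc; _+_; _*_; _∸_; _⊔_; _≤_; _<_)
open import Data.Nat.DivMod using (_/_; _%_)
open import Data.Fin using (Fin; zero; suc; _≟_)
open import Data.List using (List; []; _∷_; _++_; reverse; replicate; length)
open import Data.Product using (Σ; _×_; _,_; proj₁; proj₂)
open import Data.Integer using (+_)
open import Data.Rational using (ℚ; 0ℚ; 1ℚ) renaming (_/_ to _/ℚ_; _≤_ to _≤ℚ_; _<_ to _<ℚ_)
open import Relation.Binary.PropositionalEquality using (_≡_)
open import Relation.Nullary.Decidable using (⌊_⌋)

-- Dedekind cuts of irrationals in (0,1)
-- D q = false encodes D(q)=0 (q < α), D q = true encodes D(q)=1 (q > α).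

record IrrationalCut01 (D : ℚ → Bool) : Set where
  field
    monotone    : ∀ p q → p ≤ℚ q → D p ≡ true → D q ≡ true
    lowerNoMax  : ∀ p → D p ≡ false → Σ ℚ λ q → p <ℚ q × D q ≡ false
    upperNoMin  : ∀ p → D p ≡ true → Σ ℚ λ q → q <ℚ p × D q ≡ true
    zeroBelow   : D 0ℚ ≡ false
    oneAbove    : D 1ℚ ≡ true

-- b = B(n) for n = suc m :  b/n < α < (b+1)/n
IsBeatty : (ℚ → Bool) → (m b : ℕ) → Set
IsBeatty D m b = (D ((+ b) /ℚ suc m) ≡ false) × (D ((+ suc b) /ℚ suc m) ≡ true)

Word : Set
Word = List Bool

bitsRev : ℕ → ℕ → Word
bitsRev zero    _       = []
bitsRev (suc k) zero    = []
bitsRev (suc k) (suc n) = (if ⌊ (suc n % 2) Data.Nat.≟ 1 ⌋ then true else false) ∷ bitsRev k (suc n / 2)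

-- binary representation, most significant bit first, no leading zeros; bin 0 = "0"
bin : ℕ → Word
bin zero    = false ∷ []
bin (suc n) = reverse (bitsRev (suc n) (suc n))

padTo : ℕ → Word → Word
padTo L w = replicate (L ∸ length w) false ++ w

interleave : Word → Word → Word
interleave (a ∷ as) (b ∷ bs) = a ∷ b ∷ interleave as bs
interleave as       []       = as
interleave []       bs       = bs

-- the rational p/q written by interleaving the binary representations of p and q
-- (padded with leading zeros to a common length)
encQ : ℕ → ℕ → Word
encQ p q = interleave (padTo L (bin p)) (padTo L (bin q))
  where L = length (bin p) ⊔ length (bin q)

IsOracleFor : (ℚ → Bool) → (Word → Word) → Set
IsOracleFor D f = ∀ p q → f (encQ p (suc q)) ≡ (D ((+ p) /ℚ suc q) ∷ [])

data Move : Set where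
  L S R : Move

record Tape (A : Set) : Set where
  constructor tape
  field
    left  : List A   -- cells left of the head, nearest first
    head  : A
    right : List A   -- cells right of the head, nearest first

-- Tape alphabet Γ g = Fin (3 + g): 0 = blank, 1 = bit 0, 2 = bit 1, others extra.
Γ : ℕ → Set
Γ g = Fin (3 + g)

blank : ∀ {g} → Γ g
blank = zero

sym : ∀ {g} → Bool → Γ g
sym false = suc zero
sym true  = suc (suc zero)

-- tapes: 0 = input, 1 = query, 2 = output, 3.. = work tapes
-- states: 0 = start, 1 = halt, 2 = query, 3 = answer, others ordinary
record OTM : Set where
  field
    g : ℕ        -- number of extra tape symbols
    w : ℕ        -- number of work tapes
    s : ℕ        -- number of extra states
    δ : Fin (4 + s) → (Fin (3 + w) → Γ g) → Fin (4 + s) × (Fin (3 + w) → Γ g × Move)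

module _ (M : OTM) where
  open OTM M

  State : Set
  State = Fin (4 + s)

  TapeIx : Set
  TapeIx = Fin (3 + w)

  qStart qHalt qQuery qAnswer : State
  qStart  = zero
  qHalt   = suc zero
  qQuery  = suc (suc zero)
  qAnswer = suc (suc (suc zero))

  inTape qTape outTape : TapeIx
  inTape  = zero
  qTape   = suc zero
  outTape = suc (suc zero)

  record Config : Set where
    field
      state    : State
      tapes    : TapeIx → Tape (Γ g)
      time     : ℕ
      queries  : ℕ
      maxQuery : ℕ
  open Config public

  emptyTape : Tape (Γ g)
  emptyTape = tape [] blank []

  fromWord : Word → Tape (Γ g)
  fromWord []      = emptyTape
  fromWord (b ∷ bs) = tape [] (sym b) (Data.List.map sym bs)

  -- contents of a tape: the block of bit symbols starting at the leftmost non-blank cell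
  dropBlanks : List (Γ g) → List (Γ g)
  dropBlanks (zero ∷ xs) = dropBlanks xs
  dropBlanks xs          = xs

  takeBits : List (Γ g) → Word
  takeBits (suc zero ∷ xs)       = false ∷ takeBits xs
  takeBits (suc (suc zero) ∷ xs) = true ∷ takeBits xs
  takeBits _                     = []

  word : Tape (Γ g) → Word
  word (tape l h r) = takeBits (dropBlanks (reverse l ++ (h ∷ r)))

  moveTape : Move → Tape (Γ g) → Tape (Γ g)
  moveTape L (tape []      h r)       = tape [] blank (h ∷ r)
  moveTape L (tape (x ∷ l) h r)       = tape l x (h ∷ r)
  moveTape S t                        = t
  moveTape R (tape l h [])            = tape (h ∷ l) blank []
  moveTape R (tape l h (x ∷ r))       = tape (h ∷ l) x r

  writeTape : Γ g → Tape (Γ g) → Tape (Γ g)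
  writeTape a (tape l _ r) = tape l a r

  initConfig : Word → Config
  initConfig x = record
    { state = qStart
    ; tapes = λ i → if ⌊ i ≟ inTape ⌋ then fromWord x else emptyTape
    ; time = 0 ; queries = 0 ; maxQuery = 0 }

  -- one step; in the query state the query tape content x is replaced by f x,
  -- costing |f x| steps; the halting state is absorbing
  stepAt : (Word → Word) → State → Config → Config
  stepAt f (suc zero)       c = c
  stepAt f (suc (suc zero)) c = record
    { state    = qAnswer
    ; tapes    = λ i → if ⌊ i ≟ qTape ⌋ then fromWord (f x) else tapes c i
    ; time     = time c + length (f x)
    ; queries  = suc (queries c)
    ; maxQuery = maxQuery c ⊔ length x }
    where x = word (tapes c qTape)
  stepAt f q c = record
    { state    = proj₁ r
    ; tapes    = λ i → moveTape (proj₂ (proj₂ r i)) (writeTape (proj₁ (proj₂ r i)) (tapes c i))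
    ; time     = suc (time c)
    ; queries  = queries c
    ; maxQuery = maxQuery c }
    where r = δ q (λ i → Tape.head (tapes c i))

  step : (Word → Word) → Config → Config
  step f c = stepAt f (state c) c

  run : (Word → Word) → ℕ → Config → Config
  run f zero    c = c
  run f (suc k) c = run f k (step f c)

  Halted : Config → Set
  Halted c = state c ≡ qHalt

  output : Config → Word
  output c = word (tapes c outTape)

{-# OPTIONS --safe #-}

-- The machine finds B(n) = ⌊n α⌋ by binary search, most significant bit first.  As α < 1,
-- B(n) < n has at most ℓ = |bin n| bits.  If K is a prefix of B(n), padded to ℓ bits, then
-- K0…0 / n < α < (K1…1 + 1) / n, and the next bit is 1 exactly when the candidate c = K10…0
-- satisfies c / n < α, i.e. when the cut answers 0 on c / n.  A candidate c ≥ n needs no query,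
-- since c / n ≥ 1 > α.  This saves a query in the only case where ℓ exceeds ⌈log₂ n⌉, namely
-- n = 2^(ℓ-1), whose first candidate is n itself.  Every round sweeps the ℓ input cells a
-- bounded number of times and writes a query of length 2ℓ, so the time is O(ℓ²).

module Submission where

open import Defs renaming (sym to symbol)
open import Data.Bool using (Bool; true; false; not; _∨_; if_then_else_)
open import Data.Empty using (⊥; ⊥-elim)
open import Data.Fin using (Fin; zero; suc; #_)
import Data.Integer as ℤ
import Data.Integer.Properties as ℤP
open import Data.List using (List; []; _∷_; _++_; _ʳ++_; reverse; length; map; replicate)
import Data.List.Properties as LP
open import Data.List.Relation.Unary.All using (All; []; _∷_)
import Data.List.Relation.Unary.All.Properties as AllP
open import Data.Nat
open import Data.Nat.DivMod
open import Data.Nat.Divisibility using (divides)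
open import Data.Nat.Logarithm
open import Data.Nat.Properties
open import Data.Nat.Solver using (module +-*-Solver)
open import Data.Product using (Σ; _×_; _,_; proj₁; proj₂)
open import Data.Rational using (ℚ; 1ℚ) renaming (_/_ to _/ℚ_; _≤_ to _≤ℚ_)
import Data.Rational.Properties as ℚP
open import Data.Rational.Unnormalised using (mkℚᵘ; *≤*)
import Data.Rational.Unnormalised.Properties as UP
open import Data.Sum using (_⊎_; inj₁; inj₂)
open import Data.Unit using (⊤; tt)
open import Data.Vec using (Vec; lookup; []; _∷_)
open import Relation.Binary.PropositionalEquality
open import Relation.Nullary.Decidable using (⌊_⌋)

open +-*-Solver using (solve; _:=_; _:+_; _:*_; con)

cong₃ : ∀ {A B C D : Set} (f : A → B → C → D) {a a′ b b′ c c′} →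
        a ≡ a′ → b ≡ b′ → c ≡ c′ → f a b c ≡ f a′ b′ c′
cong₃ f refl refl refl = refl

-- Binary numerals

bit : Bool → ℕ
bit false = 0
bit true = 1

bit≤1 : ∀ b → bit b ≤ 1
bit≤1 false = z≤n
bit≤1 true = s≤s z≤n

valAcc : ℕ → List Bool → ℕ
valAcc a [] = a
valAcc a (b ∷ bs) = valAcc (2 * a + bit b) bs

val : List Bool → ℕ
val = valAcc 0

valAcc-++ : ∀ a xs ys → valAcc a (xs ++ ys) ≡ valAcc (valAcc a xs) ys
valAcc-++ a [] ys = refl
valAcc-++ a (x ∷ xs) ys = valAcc-++ _ xs ys

valAcc-split : ∀ a ys → valAcc a ys ≡ a * 2 ^ length ys + val ys
valAcc-split a [] = solve 1 (λ a → a := a :* con 1 :+ con 0) refl a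
valAcc-split a (y ∷ ys) = begin
    valAcc (2 * a + bit y) ys
  ≡⟨ valAcc-split (2 * a + bit y) ys ⟩
    (2 * a + bit y) * 2 ^ length ys + val ys
  ≡⟨ cong (_+ val ys) (lem a (bit y) (2 ^ length ys)) ⟩
    a * (2 * 2 ^ length ys) + bit y * 2 ^ length ys + val ys
  ≡⟨ +-assoc (a * (2 * 2 ^ length ys)) _ _ ⟩
    a * (2 * 2 ^ length ys) + (bit y * 2 ^ length ys + val ys)
  ≡⟨ cong (a * (2 * 2 ^ length ys) +_) (sym (valAcc-split (bit y) ys)) ⟩
    a * (2 * 2 ^ length ys) + valAcc (bit y) ys
  ≡⟨⟩
    a * 2 ^ length (y ∷ ys) + val (y ∷ ys) ∎
  where
    open ≡-Reasoning
    lem : ∀ a b p → (2 * a + b) * p ≡ a * (2 * p) + b * p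
    lem = solve 3 (λ a b p → (con 2 :* a :+ b) :* p := a :* (con 2 :* p) :+ b :* p) refl

val-++ : ∀ xs ys → val (xs ++ ys) ≡ val xs * 2 ^ length ys + val ys
val-++ xs ys = trans (valAcc-++ 0 xs ys) (valAcc-split (val xs) ys)

val-replicate-false : ∀ k → val (replicate k false) ≡ 0
val-replicate-false zero = refl
val-replicate-false (suc k) = val-replicate-false k

val-replicate-true : ∀ k → val (replicate k true) + 1 ≡ 2 ^ k
val-replicate-true zero = refl
val-replicate-true (suc k) = begin
    valAcc 1 (replicate k true) + 1
  ≡⟨ cong (_+ 1) (valAcc-split 1 (replicate k true)) ⟩
    1 * 2 ^ length (replicate k true) + val (replicate k true) + 1
  ≡⟨ cong (λ z → 1 * 2 ^ z + val (replicate k true) + 1) (LP.length-replicate k) ⟩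
    1 * 2 ^ k + val (replicate k true) + 1
  ≡⟨ +-assoc (1 * 2 ^ k) _ 1 ⟩
    1 * 2 ^ k + (val (replicate k true) + 1)
  ≡⟨ cong (1 * 2 ^ k +_) (val-replicate-true k) ⟩
    1 * 2 ^ k + 2 ^ k
  ≡⟨ solve 1 (λ p → con 1 :* p :+ p := con 2 :* p) refl (2 ^ k) ⟩
    2 ^ suc k ∎
  where open ≡-Reasoning

val-true∷replicate-false : ∀ k → val (true ∷ replicate k false) ≡ 2 ^ k
val-true∷replicate-false k = begin
    valAcc 1 (replicate k false)
  ≡⟨ valAcc-split 1 (replicate k false) ⟩
    1 * 2 ^ length (replicate k false) + val (replicate k false)
  ≡⟨ cong₂ (λ a b → 1 * 2 ^ a + b) (LP.length-replicate k) (val-replicate-false k) ⟩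
    1 * 2 ^ k + 0
  ≡⟨ solve 1 (λ p → con 1 :* p :+ con 0 := p) refl (2 ^ k) ⟩
    2 ^ k ∎
  where open ≡-Reasoning

val<2^length : ∀ xs → val xs < 2 ^ length xs
val<2^length [] = s≤s z≤n
val<2^length (x ∷ xs) = begin-strict
    valAcc (bit x) xs
  ≡⟨ valAcc-split (bit x) xs ⟩
    bit x * 2 ^ length xs + val xs
  <⟨ +-monoʳ-< (bit x * 2 ^ length xs) (val<2^length xs) ⟩
    bit x * 2 ^ length xs + 2 ^ length xs
  ≤⟨ +-monoˡ-≤ (2 ^ length xs) (*-monoˡ-≤ (2 ^ length xs) (bit≤1 x)) ⟩
    1 * 2 ^ length xs + 2 ^ length xs
  ≡⟨ solve 1 (λ p → con 1 :* p :+ p := con 2 :* p) refl (2 ^ length xs) ⟩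
    2 ^ length (x ∷ xs) ∎
  where open ≤-Reasoning

val-carry : ∀ xs k → val (xs ++ false ∷ replicate k true) + 1 ≡ val (xs ++ true ∷ replicate k false)
val-carry xs k = begin
    val (xs ++ false ∷ replicate k true) + 1
  ≡⟨ cong (_+ 1) (val-++ xs (false ∷ replicate k true)) ⟩
    val xs * 2 ^ length (false ∷ replicate k true) + val (replicate k true) + 1
  ≡⟨ cong (λ z → val xs * 2 ^ suc z + val (replicate k true) + 1) (LP.length-replicate k) ⟩
    val xs * 2 ^ suc k + val (replicate k true) + 1
  ≡⟨ +-assoc (val xs * 2 ^ suc k) _ 1 ⟩
    val xs * 2 ^ suc k + (val (replicate k true) + 1)
  ≡⟨ cong (val xs * 2 ^ suc k +_) (trans (val-replicate-true k) (sym (val-true∷replicate-false k))) ⟩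
    val xs * 2 ^ suc k + val (true ∷ replicate k false)
  ≡⟨ cong (λ z → val xs * 2 ^ suc z + val (true ∷ replicate k false)) (sym (LP.length-replicate k)) ⟩
    val xs * 2 ^ length (true ∷ replicate k false) + val (true ∷ replicate k false)
  ≡⟨ sym (val-++ xs (true ∷ replicate k false)) ⟩
    val (xs ++ true ∷ replicate k false) ∎
  where open ≡-Reasoning

bitsRev-fuel-irrelevant : ∀ k k2 n → n ≤ k → n ≤ k2 → bitsRev k n ≡ bitsRev k2 n
bitsRev-fuel-irrelevant zero k2 zero _ _ = sym (z k2)
  where
    z : ∀ k → bitsRev k 0 ≡ []
    z zero = refl
    z (suc k) = refl
bitsRev-fuel-irrelevant (suc k) zero zero _ _ = refl
bitsRev-fuel-irrelevant (suc k) (suc k2) zero _ _ = refl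
bitsRev-fuel-irrelevant (suc k) (suc k2) (suc n) (s≤s p) (s≤s q) =
  cong (_ ∷_) (bitsRev-fuel-irrelevant k k2 (suc n / 2) (≤-trans h p) (≤-trans h q))
  where
    h : suc n / 2 ≤ n
    h = s≤s⁻¹ (m/n<m (suc n) 2 (s≤s (s≤s z≤n)))

[bit+x*2]%2≡bit : ∀ x b → (bit b + x * 2) % 2 ≡ bit b
[bit+x*2]%2≡bit x false = [m+kn]%n≡m%n 0 x 2
[bit+x*2]%2≡bit x true = [m+kn]%n≡m%n 1 x 2

[bit+x*2]/2≡x : ∀ x b → (bit b + x * 2) / 2 ≡ x
[bit+x*2]/2≡x x b = trans (+-distrib-/-∣ʳ (bit b) (divides x refl)) (cong₂ _+_ (h b) (m*n/n≡m x 2))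
  where
    h : ∀ b → bit b / 2 ≡ 0
    h false = refl
    h true = refl

bin-snoc : ∀ x b → bin (bit b + suc x * 2) ≡ bin (suc x) ++ b ∷ []
bin-snoc x b = begin
    bin (bit b + suc x * 2)
  ≡⟨ cong bin (e b) ⟩
    bin (suc (y b))
  ≡⟨⟩
    reverse (bitsRev (suc (y b)) (suc (y b)))
  ≡⟨ cong reverse (h b) ⟩
    reverse (b ∷ bitsRev (y b) (suc x))
  ≡⟨ LP.unfold-reverse b (bitsRev (y b) (suc x)) ⟩
    reverse (bitsRev (y b) (suc x)) ++ b ∷ []
  ≡⟨ cong (λ z → reverse z ++ b ∷ []) (bitsRev-fuel-irrelevant (y b) (suc x) (suc x) (yb b) ≤-refl) ⟩
    bin (suc x) ++ b ∷ [] ∎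
  where
    open ≡-Reasoning
    y : Bool → ℕ
    y false = suc (x * 2)
    y true = suc (suc (x * 2))
    e : ∀ b → bit b + suc x * 2 ≡ suc (y b)
    e false = refl
    e true = refl
    yb : ∀ b → suc x ≤ y b
    yb false = s≤s (≤-trans (m≤m*n x 2) ≤-refl)
    yb true = ≤-trans (s≤s (m≤m*n x 2)) (n≤1+n _)
    h : ∀ b → bitsRev (suc (y b)) (suc (y b)) ≡ b ∷ bitsRev (y b) (suc x)
    h false = cong₂ (λ u v → (if ⌊ u Data.Nat.≟ 1 ⌋ then true else false) ∷ bitsRev (y false) v)
                (trans (cong (_% 2) (sym (e false))) ([bit+x*2]%2≡bit (suc x) false))
                (trans (cong (_/ 2) (sym (e false))) ([bit+x*2]/2≡x (suc x) false))
    h true = cong₂ (λ u v → (if ⌊ u Data.Nat.≟ 1 ⌋ then true else false) ∷ bitsRev (y true) v)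
                (trans (cong (_% 2) (sym (e true))) ([bit+x*2]%2≡bit (suc x) true))
                (trans (cong (_/ 2) (sym (e true))) ([bit+x*2]/2≡x (suc x) true))

bin-valAcc : ∀ ws a → bin (valAcc (suc a) ws) ≡ bin (suc a) ++ ws
bin-valAcc [] a = sym (LP.++-identityʳ _)
bin-valAcc (w ∷ ws) a = begin
    bin (valAcc (2 * suc a + bit w) ws)
  ≡⟨ bin-valAcc ws _ ⟩
    bin (2 * suc a + bit w) ++ ws
  ≡⟨ cong (λ z → bin z ++ ws) (trans (+-comm (2 * suc a) (bit w)) (cong (bit w +_) (*-comm 2 (suc a)))) ⟩
    bin (bit w + suc a * 2) ++ ws
  ≡⟨ cong (_++ ws) (bin-snoc a w) ⟩
    (bin (suc a) ++ w ∷ []) ++ ws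
  ≡⟨ LP.++-assoc (bin (suc a)) (w ∷ []) ws ⟩
    bin (suc a) ++ w ∷ ws ∎
  where open ≡-Reasoning

stripZeros : List Bool → List Bool
stripZeros [] = false ∷ []
stripZeros (false ∷ ws) = stripZeros ws
stripZeros (true ∷ ws) = true ∷ ws

bin-val : ∀ ws → bin (val ws) ≡ stripZeros ws
bin-val [] = refl
bin-val (false ∷ ws) = bin-val ws
bin-val (true ∷ ws) = bin-valAcc ws 0

length-stripZeros : ∀ w ws → length (stripZeros (w ∷ ws)) ≤ suc (length ws)
length-stripZeros true ws = ≤-refl
length-stripZeros false [] = ≤-refl
length-stripZeros false (w ∷ ws) = m≤n⇒m≤1+n (length-stripZeros w ws)

padTo-stripZeros : ∀ w ws → padTo (length (w ∷ ws)) (stripZeros (w ∷ ws)) ≡ w ∷ ws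
padTo-stripZeros true ws = cong (λ z → replicate z false ++ true ∷ ws) (n∸n≡0 (length ws))
padTo-stripZeros false [] = refl
padTo-stripZeros false (w ∷ ws) = begin
    replicate (suc (suc (length ws)) ∸ length (stripZeros (w ∷ ws))) false ++ stripZeros (w ∷ ws)
  ≡⟨ cong (λ z → replicate z false ++ stripZeros (w ∷ ws)) (+-∸-assoc 1 (length-stripZeros w ws)) ⟩
    false ∷ (replicate (suc (length ws) ∸ length (stripZeros (w ∷ ws))) false ++ stripZeros (w ∷ ws))
  ≡⟨ cong (false ∷_) (padTo-stripZeros w ws) ⟩
    false ∷ w ∷ ws ∎
  where open ≡-Reasoning

divMod2 : ∀ x → Σ Bool λ b → Σ ℕ λ q → x ≡ bit b + q * 2
divMod2 zero = false , 0 , refl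
divMod2 (suc x) with divMod2 x
... | false , q , e = true , q , cong suc e
... | true , q , e = false , suc q , cong suc e

bin-spec : ∀ k x → x ≤ k → val (bin x) ≡ x × (0 < x → Σ (List Bool) λ ws → bin x ≡ true ∷ ws)
bin-spec k x x≤k with divMod2 x
bin-spec k x x≤k | false , zero , refl = refl , λ ()
bin-spec k x x≤k | true , zero , refl = refl , λ _ → [] , refl
bin-spec (suc k) x x≤k | b , suc q , refl = v , λ _ → hd
  where
    ih = bin-spec k (suc q) (s≤s⁻¹ (≤-trans qlt x≤k))
      where
        qlt : suc (suc q) ≤ bit b + suc q * 2
        qlt = ≤-trans (s≤s (s≤s (m≤m*n q 2))) (m≤n+m _ (bit b))
    ws = proj₁ (proj₂ ih (s≤s z≤n))
    v : val (bin (bit b + suc q * 2)) ≡ bit b + suc q * 2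
    v = begin
        val (bin (bit b + suc q * 2))
      ≡⟨ cong val (bin-snoc q b) ⟩
        val (bin (suc q) ++ b ∷ [])
      ≡⟨ valAcc-++ 0 (bin (suc q)) (b ∷ []) ⟩
        2 * val (bin (suc q)) + bit b
      ≡⟨ cong (λ z → 2 * z + bit b) (proj₁ ih) ⟩
        2 * suc q + bit b
      ≡⟨ trans (+-comm (2 * suc q) (bit b)) (cong (bit b +_) (*-comm 2 (suc q))) ⟩
        bit b + suc q * 2 ∎
      where open ≡-Reasoning
    hd : Σ (List Bool) λ ws → bin (bit b + suc q * 2) ≡ true ∷ ws
    hd = ws ++ b ∷ [] , trans (bin-snoc q b) (cong (_++ b ∷ []) (proj₂ (proj₂ ih (s≤s z≤n))))

val-bin : ∀ x → val (bin x) ≡ x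
val-bin x = proj₁ (bin-spec x x ≤-refl)

bin-suc-leading-one : ∀ m → Σ (List Bool) λ ws → bin (suc m) ≡ true ∷ ws
bin-suc-leading-one m = proj₂ (bin-spec (suc m) (suc m) ≤-refl) (s≤s z≤n)

length-snoc : ∀ {A : Set} (xs : List A) x → length (xs ++ x ∷ []) ≡ suc (length xs)
length-snoc xs x = trans (LP.length-++ xs) (+-comm (length xs) 1)

length-interleave : ∀ (as bs : Word) → length (interleave as bs) ≡ length as + length bs
length-interleave (a ∷ as) (b ∷ bs) = cong suc (trans (cong suc (length-interleave as bs)) (sym (+-suc (length as) (length bs))))
length-interleave [] [] = refl
length-interleave (a ∷ as) [] = sym (+-identityʳ _)
length-interleave [] (b ∷ bs) = refl

encQ-val : ∀ c cs n → length (bin n) ≡ suc (length cs) → encQ (val (c ∷ cs)) n ≡ interleave (c ∷ cs) (bin n)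
encQ-val c cs n e = begin
    interleave (padTo (length (bin (val (c ∷ cs))) ⊔ length (bin n)) (bin (val (c ∷ cs))))
               (padTo (length (bin (val (c ∷ cs))) ⊔ length (bin n)) (bin n))
  ≡⟨ cong (λ w → interleave (padTo (length w ⊔ length (bin n)) w) (padTo (length w ⊔ length (bin n)) (bin n))) (bin-val (c ∷ cs)) ⟩
    interleave (padTo (length w ⊔ length (bin n)) w) (padTo (length w ⊔ length (bin n)) (bin n))
  ≡⟨ cong (λ z → interleave (padTo z w) (padTo z (bin n)))
       (m≤n⇒m⊔n≡n (subst (length w ≤_) (sym e) (length-stripZeros c cs))) ⟩
    interleave (padTo (length (bin n)) w) (padTo (length (bin n)) (bin n))
  ≡⟨ cong₂ interleave (trans (cong (λ z → padTo z w) e) (padTo-stripZeros c cs))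
                      (cong (λ z → replicate z false ++ bin n) (n∸n≡0 (length (bin n)))) ⟩
    interleave (c ∷ cs) (bin n) ∎
  where
    open ≡-Reasoning
    w = stripZeros (c ∷ cs)

data Cmp : Set where
  eq lt gt : Cmp

cmpStep : Cmp → Bool → Bool → Cmp
cmpStep eq false false = eq
cmpStep eq true true = eq
cmpStep eq false true = lt
cmpStep eq true false = gt
cmpStep lt _ _ = lt
cmpStep gt _ _ = gt

compareFrom : Cmp → List Bool → List Bool → Cmp
compareFrom c (x ∷ xs) (y ∷ ys) = compareFrom (cmpStep c x y) xs ys
compareFrom c _ _ = c

CmpSpec : Cmp → ℕ → ℕ → Set
CmpSpec eq a b = a ≡ b
CmpSpec lt a b = a < b
CmpSpec gt a b = b < a

2*-+bit-mono-< : ∀ a b x y → a < b → 2 * a + bit x < 2 * b + bit y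
2*-+bit-mono-< a b x y a<b = begin-strict
    2 * a + bit x
  ≤⟨ +-monoʳ-≤ (2 * a) (bit≤1 x) ⟩
    2 * a + 1
  <⟨ ≤-reflexive (solve 1 (λ a → con 1 :+ (con 2 :* a :+ con 1) := con 2 :* (con 1 :+ a)) refl a) ⟩
    2 * suc a
  ≤⟨ *-monoʳ-≤ 2 a<b ⟩
    2 * b
  ≤⟨ m≤m+n (2 * b) (bit y) ⟩
    2 * b + bit y ∎
  where open ≤-Reasoning

CmpSpec-step : ∀ c a b x y → CmpSpec c a b → CmpSpec (cmpStep c x y) (2 * a + bit x) (2 * b + bit y)
CmpSpec-step eq a .a false false refl = refl
CmpSpec-step eq a .a true true refl = refl
CmpSpec-step eq a .a false true refl = +-monoʳ-< (2 * a) (s≤s z≤n)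
CmpSpec-step eq a .a true false refl = +-monoʳ-< (2 * a) (s≤s z≤n)
CmpSpec-step lt a b x y r = 2*-+bit-mono-< a b x y r
CmpSpec-step gt a b x y r = 2*-+bit-mono-< b a y x r

CmpSpec-compareFrom : ∀ c a b xs ys → length xs ≡ length ys → CmpSpec c a b → CmpSpec (compareFrom c xs ys) (valAcc a xs) (valAcc b ys)
CmpSpec-compareFrom c a b [] [] _ r = r
CmpSpec-compareFrom c a b (x ∷ xs) (y ∷ ys) e r = CmpSpec-compareFrom _ _ _ xs ys (suc-injective e) (CmpSpec-step c a b x y r)

compare-lt⇒< : ∀ xs ys → length xs ≡ length ys → compareFrom eq xs ys ≡ lt → val xs < val ys
compare-lt⇒< xs ys e h with compareFrom eq xs ys | CmpSpec-compareFrom eq 0 0 xs ys e refl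
compare-lt⇒< xs ys e refl | lt | r = r

compare-≢lt⇒≥ : ∀ xs ys → length xs ≡ length ys → (compareFrom eq xs ys ≡ lt → ⊥) → val ys ≤ val xs
compare-≢lt⇒≥ xs ys e h with compareFrom eq xs ys | CmpSpec-compareFrom eq 0 0 xs ys e refl
... | eq | r = ≤-reflexive (sym r)
... | gt | r = <⇒≤ r
... | lt | r = ⊥-elim (h refl)

-- Fractions b / n, the cut, and logarithms

ratio : ℕ → ℕ → ℚ
ratio a m = (ℤ.+ a) /ℚ suc m

ratio-≤ : ∀ a m b n → a * suc n ≤ b * suc m → ratio a m ≤ℚ ratio b n
ratio-≤ a m b n h = ℚP.toℚᵘ-cancel-≤
  (UP.≤-respˡ-≃ (UP.≃-sym (ℚP.toℚᵘ-fromℚᵘ (mkℚᵘ (ℤ.+ a) m)))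
    (UP.≤-respʳ-≃ (UP.≃-sym (ℚP.toℚᵘ-fromℚᵘ (mkℚᵘ (ℤ.+ b) n)))
    (*≤* (subst₂ ℤ._≤_ (ℤP.pos-* a (suc n)) (ℤP.pos-* b (suc m)) (ℤ.+≤+ h)))))

module _ {D : ℚ → Bool} (cut : IrrationalCut01 D) where
  open IrrationalCut01 cut

  D-ratio-≥ : ∀ m a → suc m ≤ a → D (ratio a m) ≡ true
  D-ratio-≥ m a h = monotone 1ℚ (ratio a m) one≤ratio oneAbove
    where
      one≤ratio : 1ℚ ≤ℚ ratio a m
      one≤ratio = ratio-≤ 1 0 a m (subst₂ _≤_ (sym (*-identityˡ (suc m))) (sym (*-identityʳ a)) h)

  D-ratio-zero : ∀ m → D (ratio 0 m) ≡ false
  D-ratio-zero m = subst (λ z → D z ≡ false) (sym (ℚP.0/n≡0 (suc m))) zeroBelow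

2^k≤n⇒k≤⌈log₂n⌉ : ∀ k n → 2 ^ k ≤ n → k ≤ ⌈log₂ n ⌉
2^k≤n⇒k≤⌈log₂n⌉ k n h = subst (_≤ ⌈log₂ n ⌉) (⌈log₂2^n⌉≡n k) (⌈log₂⌉-mono-≤ h)

2^k<n⇒k<⌈log₂n⌉ : ∀ k n → 2 ^ k < n → k < ⌈log₂ n ⌉
2^k<n⇒k<⌈log₂n⌉ zero n h = 2^k≤n⇒k≤⌈log₂n⌉ 1 n h
2^k<n⇒k<⌈log₂n⌉ (suc k) n h = pred-< (subst (suc k ≤_) (⌈log₂⌈n/2⌉⌉≡⌈log₂n⌉∸1 n) halved)
  where
    p = 2 ^ k
    2^k<⌈n/2⌉ : 2 ^ k < ⌈ n /2⌉
    2^k<⌈n/2⌉ = subst (_≤ ⌈ n /2⌉) (cong suc (sym (n≡⌊n+n/2⌋ p)))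
                  (⌈n/2⌉-mono (subst (λ z → suc (p + z) ≤ n) (+-identityʳ p) h))
    halved : suc k ≤ ⌈log₂ ⌈ n /2⌉ ⌉
    halved = 2^k<n⇒k<⌈log₂n⌉ k ⌈ n /2⌉ 2^k<⌈n/2⌉
    pred-< : ∀ {a} → suc k ≤ a ∸ 1 → suc (suc k) ≤ a
    pred-< {suc a} q = s≤s q

-- The machine

-- The input tape holds one cell per bit of n.  Besides that input bit, a cell records the state
-- of the corresponding bit of the answer: not yet reached (plain), the 1 of the current
-- candidate (probe), or known (fixed).  Query and output tapes only use plain symbols.
data Sym : Set where
  blk : Sym
  plain probe : Bool → Sym
  fixed : Bool → Bool → Sym

symTable : Vec Sym 9
symTable = blk ∷ plain false ∷ plain true ∷ probe false ∷ probe true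
         ∷ fixed false false ∷ fixed false true ∷ fixed true false ∷ fixed true true ∷ []

encodeSym : Sym → Fin 9
encodeSym blk = # 0
encodeSym (plain false) = # 1
encodeSym (plain true) = # 2
encodeSym (probe false) = # 3
encodeSym (probe true) = # 4
encodeSym (fixed false false) = # 5
encodeSym (fixed false true) = # 6
encodeSym (fixed true false) = # 7
encodeSym (fixed true true) = # 8

decodeSym : Fin 9 → Sym
decodeSym = lookup symTable

decodeSym-encodeSym : ∀ x → decodeSym (encodeSym x) ≡ x
decodeSym-encodeSym blk = refl
decodeSym-encodeSym (plain false) = refl
decodeSym-encodeSym (plain true) = refl
decodeSym-encodeSym (probe false) = refl
decodeSym-encodeSym (probe true) = refl
decodeSym-encodeSym (fixed false false) = refl
decodeSym-encodeSym (fixed false true) = refl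
decodeSym-encodeSym (fixed true false) = refl
decodeSym-encodeSym (fixed true true) = refl

-- In mode beforeProbe d the scan has not yet placed the new probe; d is the oracle's answer
-- about the previous candidate.
data Mode : Set where
  beforeProbe : Bool → Mode
  afterProbe : Mode

data Ctl : Set where
  scan : Mode → Cmp → Ctl
  answer copyInput copyProbe rewind rewindOut : Ctl
  emit : Bool → Ctl

data AState : Set where
  halt query : AState
  ctl : Ctl → AState

-- Codes 0–3 are imposed by the machine model: start, halt, query and answer state.
encodeCtl : Ctl → Fin 18
encodeCtl (scan (beforeProbe true) eq) = # 0
encodeCtl answer = # 3
encodeCtl (scan (beforeProbe true) lt) = # 4
encodeCtl (scan (beforeProbe true) gt) = # 5
encodeCtl (scan (beforeProbe false) eq) = # 6
encodeCtl (scan (beforeProbe false) lt) = # 7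
encodeCtl (scan (beforeProbe false) gt) = # 8
encodeCtl (scan afterProbe eq) = # 9
encodeCtl (scan afterProbe lt) = # 10
encodeCtl (scan afterProbe gt) = # 11
encodeCtl copyInput = # 12
encodeCtl copyProbe = # 13
encodeCtl rewind = # 14
encodeCtl rewindOut = # 15
encodeCtl (emit false) = # 16
encodeCtl (emit true) = # 17

encodeState : AState → Fin 18
encodeState halt = # 1
encodeState query = # 2
encodeState (ctl n) = encodeCtl n

-- Codes 1 and 2 never reach the transition function, so their entries are arbitrary.
ctlTable : Vec Ctl 18
ctlTable = scan (beforeProbe true) eq ∷ answer ∷ answer ∷ answer
         ∷ scan (beforeProbe true) lt ∷ scan (beforeProbe true) gt
         ∷ scan (beforeProbe false) eq ∷ scan (beforeProbe false) lt ∷ scan (beforeProbe false) gt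
         ∷ scan afterProbe eq ∷ scan afterProbe lt ∷ scan afterProbe gt
         ∷ copyInput ∷ copyProbe ∷ rewind ∷ rewindOut ∷ emit false ∷ emit true ∷ []

decodeCtl : Fin 18 → Ctl
decodeCtl = lookup ctlTable

decodeCtl-encodeCtl : ∀ n → decodeCtl (encodeCtl n) ≡ n
decodeCtl-encodeCtl (scan (beforeProbe true) eq) = refl
decodeCtl-encodeCtl (scan (beforeProbe true) lt) = refl
decodeCtl-encodeCtl (scan (beforeProbe true) gt) = refl
decodeCtl-encodeCtl (scan (beforeProbe false) eq) = refl
decodeCtl-encodeCtl (scan (beforeProbe false) lt) = refl
decodeCtl-encodeCtl (scan (beforeProbe false) gt) = refl
decodeCtl-encodeCtl (scan afterProbe eq) = refl
decodeCtl-encodeCtl (scan afterProbe lt) = refl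
decodeCtl-encodeCtl (scan afterProbe gt) = refl
decodeCtl-encodeCtl answer = refl
decodeCtl-encodeCtl copyInput = refl
decodeCtl-encodeCtl copyProbe = refl
decodeCtl-encodeCtl rewind = refl
decodeCtl-encodeCtl rewindOut = refl
decodeCtl-encodeCtl (emit false) = refl
decodeCtl-encodeCtl (emit true) = refl

record Action : Set where
  constructor act
  field
    next : AState
    w0 : Sym
    m0 : Move
    w1 : Sym
    m1 : Move
    w2 : Sym
    m2 : Move
open Action

inputBit : Sym → Bool
inputBit (plain b) = b
inputBit (probe b) = b
inputBit (fixed b _) = b
inputBit blk = false

probeBit : Sym → Bool
probeBit (plain _) = false
probeBit (probe _) = true
probeBit (fixed _ b) = b
probeBit blk = false

-- The old probe becomes the answer bit not d (the answer false means candidate/n < α), the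
-- first plain cell becomes the new probe; meanwhile the candidate is compared with n.
scanCell : Mode → Cmp → Sym → Sym × Mode × Cmp
scanCell m c (fixed n b) = fixed n b , m , cmpStep c b n
scanCell (beforeProbe d) c (probe n) = fixed n (not d) , beforeProbe d , cmpStep c (not d) n
scanCell (beforeProbe d) c (plain n) = probe n , afterProbe , cmpStep c true n
scanCell afterProbe c (plain n) = plain n , afterProbe , cmpStep c false n
scanCell afterProbe c (probe n) = probe n , afterProbe , cmpStep c true n
scanCell m c blk = blk , m , c

-- At the right end: no probe placed means all bits are known; a candidate ≥ n is not queried,
-- the next scan treating it as the answer true.
δscan : Mode → Cmp → Sym → Sym → Sym → Action
δscan (beforeProbe d) c blk y z = act (ctl rewindOut) blk L y S z S
δscan afterProbe lt blk y z = act (ctl copyInput) blk L y S z S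
δscan afterProbe eq blk y z = act (ctl rewind) blk L y S z S
δscan afterProbe gt blk y z = act (ctl rewind) blk L y S z S
δscan m c x y z = act (ctl (scan (proj₁ (proj₂ r)) (proj₂ (proj₂ r)))) (proj₁ r) R y S z S
  where r = scanCell m c x

-- The flag records whether a 1 has been emitted, so that leading zeros are skipped.
δemit : Bool → Sym → Sym → Sym → Action
δemit false blk y z = act halt blk S y S (plain false) S
δemit true blk y z = act halt blk S y S z S
δemit false (fixed n false) y z = act (ctl (emit false)) (fixed n false) R y S z S
δemit false (fixed n true) y z = act (ctl (emit true)) (fixed n true) R y S (plain true) R
δemit true (fixed n b) y z = act (ctl (emit true)) (fixed n b) R y S (plain b) R
δemit s x y z = act halt x S y S z S

δctl : Ctl → Sym → Sym → Sym → Action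
δctl (scan m c) x y z = δscan m c x y z
δctl answer x (plain d) z = act (ctl (scan (beforeProbe d) eq)) x S (plain d) S z S
δctl answer x y z = act halt x S y S z S
δctl copyInput blk y z = act query blk R y S z S
δctl copyInput x y z = act (ctl copyProbe) x S (plain (inputBit x)) L z S
δctl copyProbe x y z = act (ctl copyInput) x L (plain (probeBit x)) L z S
δctl rewind blk y z = act (ctl (scan (beforeProbe true) eq)) blk R y S z S
δctl rewind x y z = act (ctl rewind) x L y S z S
δctl rewindOut blk y z = act (ctl (emit false)) blk R y S z S
δctl rewindOut x y z = act (ctl rewindOut) x L y S z S
δctl (emit s) x y z = δemit s x y z

select₃ : ∀ {A : Set} → A → A → A → Fin 3 → A
select₃ a b c zero = a
select₃ a b c (suc zero) = b
select₃ a b c (suc (suc zero)) = c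

encodeAction : Action → Fin 18 × (Fin 3 → Fin 9 × Move)
encodeAction o = encodeState (next o) , select₃ (encodeSym (w0 o) , m0 o) (encodeSym (w1 o) , m1 o) (encodeSym (w2 o) , m2 o)

beattyMachine : OTM
beattyMachine = record
  { g = 6 ; w = 0 ; s = 14
  ; δ = λ q h → encodeAction (δctl (decodeCtl q) (decodeSym (h zero)) (decodeSym (h (suc zero))) (decodeSym (h (suc (suc zero))))) }

-- Simulation by an oracle Turing machine

mapTape : ∀ {A B : Set} → (A → B) → Tape A → Tape B
mapTape h (tape l x r) = tape (map h l) (h x) (map h r)

moveS : Move → Tape Sym → Tape Sym
moveS L (tape []      h r)       = tape [] blk (h ∷ r)
moveS L (tape (x ∷ l) h r)       = tape l x (h ∷ r)
moveS S t                        = t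
moveS R (tape l h [])            = tape (h ∷ l) blk []
moveS R (tape l h (x ∷ r))       = tape (h ∷ l) x r

writeS : Sym → Tape Sym → Tape Sym
writeS a t = tape (Tape.left t) a (Tape.right t)

move-write-encode : ∀ mv w t → moveTape beattyMachine mv (writeTape beattyMachine (encodeSym w) (mapTape encodeSym t))
                                ≡ mapTape encodeSym (moveS mv (writeS w t))
move-write-encode L w (tape [] h r) = refl
move-write-encode L w (tape (x ∷ l) h r) = refl
move-write-encode S w (tape l h r) = refl
move-write-encode R w (tape l h []) = refl
move-write-encode R w (tape l h (x ∷ r)) = refl

dropBlanksS : List Sym → List Sym
dropBlanksS (blk ∷ xs) = dropBlanksS xs
dropBlanksS xs = xs

takeBitsS : List Sym → Word
takeBitsS (plain b ∷ xs) = b ∷ takeBitsS xs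
takeBitsS _ = []

wordS : Tape Sym → Word
wordS (tape l h r) = takeBitsS (dropBlanksS (reverse l ++ (h ∷ r)))

dropBlanks-encode : ∀ xs → dropBlanks beattyMachine (map encodeSym xs) ≡ map encodeSym (dropBlanksS xs)
dropBlanks-encode [] = refl
dropBlanks-encode (blk ∷ xs) = dropBlanks-encode xs
dropBlanks-encode (plain false ∷ xs) = refl
dropBlanks-encode (plain true ∷ xs) = refl
dropBlanks-encode (probe false ∷ xs) = refl
dropBlanks-encode (probe true ∷ xs) = refl
dropBlanks-encode (fixed false false ∷ xs) = refl
dropBlanks-encode (fixed false true ∷ xs) = refl
dropBlanks-encode (fixed true false ∷ xs) = refl
dropBlanks-encode (fixed true true ∷ xs) = refl

takeBits-encode : ∀ xs → takeBits beattyMachine (map encodeSym xs) ≡ takeBitsS xs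
takeBits-encode [] = refl
takeBits-encode (blk ∷ xs) = refl
takeBits-encode (plain false ∷ xs) = cong (false ∷_) (takeBits-encode xs)
takeBits-encode (plain true ∷ xs) = cong (true ∷_) (takeBits-encode xs)
takeBits-encode (probe false ∷ xs) = refl
takeBits-encode (probe true ∷ xs) = refl
takeBits-encode (fixed false false ∷ xs) = refl
takeBits-encode (fixed false true ∷ xs) = refl
takeBits-encode (fixed true false ∷ xs) = refl
takeBits-encode (fixed true true ∷ xs) = refl

word-encode : ∀ t → word beattyMachine (mapTape encodeSym t) ≡ wordS t
word-encode (tape l h r) = begin
    takeBits beattyMachine (dropBlanks beattyMachine (reverse (map encodeSym l) ++ (encodeSym h ∷ map encodeSym r)))
  ≡⟨ cong (λ z → takeBits beattyMachine (dropBlanks beattyMachine (z ++ (encodeSym h ∷ map encodeSym r)))) (sym (LP.reverse-map encodeSym l)) ⟩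
    takeBits beattyMachine (dropBlanks beattyMachine (map encodeSym (reverse l) ++ map encodeSym (h ∷ r)))
  ≡⟨ cong (λ z → takeBits beattyMachine (dropBlanks beattyMachine z)) (sym (LP.map-++ encodeSym (reverse l) (h ∷ r))) ⟩
    takeBits beattyMachine (dropBlanks beattyMachine (map encodeSym (reverse l ++ (h ∷ r))))
  ≡⟨ cong (takeBits beattyMachine) (dropBlanks-encode (reverse l ++ (h ∷ r))) ⟩
    takeBits beattyMachine (map encodeSym (dropBlanksS (reverse l ++ (h ∷ r))))
  ≡⟨ takeBits-encode _ ⟩
    wordS (tape l h r) ∎
  where open ≡-Reasoning

fromWordS : Word → Tape Sym
fromWordS [] = tape [] blk []
fromWordS (b ∷ bs) = tape [] (plain b) (map plain bs)

symbol≡encode-plain : ∀ b → symbol {6} b ≡ encodeSym (plain b)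
symbol≡encode-plain false = refl
symbol≡encode-plain true = refl

fromWord-encode : ∀ w → fromWord beattyMachine w ≡ mapTape encodeSym (fromWordS w)
fromWord-encode [] = refl
fromWord-encode (b ∷ bs) = cong₂ (tape []) (symbol≡encode-plain b)
  (trans (LP.map-cong symbol≡encode-plain bs) (LP.map-∘ bs))

record AConfig : Set where
  constructor aconf
  field
    st : AState
    t0 t1 t2 : Tape Sym
    tm qn mq : ℕ
open AConfig

tapesS : AConfig → Fin 3 → Tape Sym
tapesS a = select₃ (t0 a) (t1 a) (t2 a)

applyAction : Action → AConfig → AConfig
applyAction o a = aconf (next o) (moveS (m0 o) (writeS (w0 o) (t0 a))) (moveS (m1 o) (writeS (w1 o) (t1 a)))
  (moveS (m2 o) (writeS (w2 o) (t2 a))) (suc (tm a)) (qn a) (mq a)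

module Run (f : Word → Word) where

  stepS : AConfig → AConfig
  stepS (aconf halt t0 t1 t2 tm qn mq) = aconf halt t0 t1 t2 tm qn mq
  stepS (aconf query t0 t1 t2 tm qn mq) =
    aconf (ctl answer) t0 (fromWordS (f (wordS t1))) t2 (tm + length (f (wordS t1))) (suc qn) (mq ⊔ length (wordS t1))
  stepS a@(aconf (ctl n) t0 t1 t2 tm qn mq) = applyAction (δctl n (Tape.head t0) (Tape.head t1) (Tape.head t2)) a

  runS : ℕ → AConfig → AConfig
  runS zero a = a
  runS (suc k) a = runS k (stepS a)

  runS-+ : ∀ m n a → runS (m + n) a ≡ runS n (runS m a)
  runS-+ zero n a = refl
  runS-+ (suc m) n a = runS-+ m n (stepS a)

  record Simulates (c : Config beattyMachine) (a : AConfig) : Set where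
    field
      state≡ : state c ≡ encodeState (st a)
      tapes≡ : ∀ i → tapes c i ≡ mapTape encodeSym (tapesS a i)
      time≡ : time c ≡ tm a
      queries≡ : queries c ≡ qn a
      maxQuery≡ : maxQuery c ≡ mq a
  open Simulates

  ordinaryStep : Fin 18 → Config beattyMachine → Config beattyMachine
  ordinaryStep q c = record
    { state    = proj₁ r
    ; tapes    = λ i → moveTape beattyMachine (proj₂ (proj₂ r i)) (writeTape beattyMachine (proj₁ (proj₂ r i)) (tapes c i))
    ; time     = suc (time c)
    ; queries  = queries c
    ; maxQuery = maxQuery c }
    where r = OTM.δ beattyMachine q (λ i → Tape.head (tapes c i))

  stepAt-ordinary : ∀ n c → stepAt beattyMachine f (encodeCtl n) c ≡ ordinaryStep (encodeCtl n) c
  stepAt-ordinary (scan (beforeProbe true) eq) c = refl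
  stepAt-ordinary (scan (beforeProbe true) lt) c = refl
  stepAt-ordinary (scan (beforeProbe true) gt) c = refl
  stepAt-ordinary (scan (beforeProbe false) eq) c = refl
  stepAt-ordinary (scan (beforeProbe false) lt) c = refl
  stepAt-ordinary (scan (beforeProbe false) gt) c = refl
  stepAt-ordinary (scan afterProbe eq) c = refl
  stepAt-ordinary (scan afterProbe lt) c = refl
  stepAt-ordinary (scan afterProbe gt) c = refl
  stepAt-ordinary answer c = refl
  stepAt-ordinary copyInput c = refl
  stepAt-ordinary copyProbe c = refl
  stepAt-ordinary rewind c = refl
  stepAt-ordinary rewindOut c = refl
  stepAt-ordinary (emit false) c = refl
  stepAt-ordinary (emit true) c = refl

  decodeSym-head : ∀ {t : Tape (Fin 9)} {u : Tape Sym} → t ≡ mapTape encodeSym u → decodeSym (Tape.head t) ≡ Tape.head u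
  decodeSym-head {u = tape l h r} refl = decodeSym-encodeSym h

  simulate-ordinary : ∀ n c t0 t1 t2 tm qn mq → Simulates c (aconf (ctl n) t0 t1 t2 tm qn mq) →
         Simulates (ordinaryStep (encodeCtl n) c) (stepS (aconf (ctl n) t0 t1 t2 tm qn mq))
  simulate-ordinary n c t0 t1 t2 tm qn mq rel = record
    { state≡ = cong proj₁ eqδ
    ; tapes≡ = tp
    ; time≡ = cong suc (time≡ rel)
    ; queries≡ = queries≡ rel
    ; maxQuery≡ = maxQuery≡ rel }
    where
      o = δctl n (Tape.head t0) (Tape.head t1) (Tape.head t2)
      H = λ (i : Fin 3) → Tape.head (tapes c i)
      eqδ : OTM.δ beattyMachine (encodeCtl n) H ≡ encodeAction o
      eqδ = trans (cong (λ q → encodeAction (δctl q _ _ _)) (decodeCtl-encodeCtl n))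
        (cong₃ (λ x y z → encodeAction (δctl n x y z))
          (decodeSym-head (tapes≡ rel zero)) (decodeSym-head (tapes≡ rel (suc zero))) (decodeSym-head (tapes≡ rel (suc (suc zero)))))
      F : (Fin 18 × (Fin 3 → Fin 9 × Move)) → Fin 3 → Tape (Fin 9) → Tape (Fin 9)
      F r i t = moveTape beattyMachine (proj₂ (proj₂ r i)) (writeTape beattyMachine (proj₁ (proj₂ r i)) t)
      tp : ∀ i → F (OTM.δ beattyMachine (encodeCtl n) H) i (tapes c i) ≡ mapTape encodeSym (tapesS (stepS (aconf (ctl n) t0 t1 t2 tm qn mq)) i)
      tp zero = trans (cong₂ (λ r t → F r zero t) eqδ (tapes≡ rel zero)) (move-write-encode (m0 o) (w0 o) t0)
      tp (suc zero) = trans (cong₂ (λ r t → F r (suc zero) t) eqδ (tapes≡ rel (suc zero))) (move-write-encode (m1 o) (w1 o) t1)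
      tp (suc (suc zero)) = trans (cong₂ (λ r t → F r (suc (suc zero)) t) eqδ (tapes≡ rel (suc (suc zero)))) (move-write-encode (m2 o) (w2 o) t2)

  simulate-query : ∀ c t0 t1 t2 tm qn mq → Simulates c (aconf query t0 t1 t2 tm qn mq) →
         Simulates (stepAt beattyMachine f (encodeState query) c) (stepS (aconf query t0 t1 t2 tm qn mq))
  simulate-query c t0 t1 t2 tm qn mq rel = record
    { state≡ = refl
    ; tapes≡ = tp
    ; time≡ = cong₂ _+_ (time≡ rel) (cong (λ x → length (f x)) wq)
    ; queries≡ = cong suc (queries≡ rel)
    ; maxQuery≡ = cong₂ _⊔_ (maxQuery≡ rel) (cong length wq) }
    where
      wq : word beattyMachine (tapes c (suc zero)) ≡ wordS t1
      wq = trans (cong (word beattyMachine) (tapes≡ rel (suc zero))) (word-encode t1)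
      tp : ∀ i → tapes (stepAt beattyMachine f (encodeState query) c) i
                 ≡ mapTape encodeSym (tapesS (stepS (aconf query t0 t1 t2 tm qn mq)) i)
      tp zero = tapes≡ rel zero
      tp (suc zero) = trans (cong (λ x → fromWord beattyMachine (f x)) wq) (fromWord-encode _)
      tp (suc (suc zero)) = tapes≡ rel (suc (suc zero))

  simulate-step : ∀ c a → Simulates c a → Simulates (step beattyMachine f c) (stepS a)
  simulate-step c (aconf halt t0 t1 t2 tm qn mq) rel =
    subst (λ q → Simulates (stepAt beattyMachine f q c) _) (sym (state≡ rel)) rel
  simulate-step c (aconf query t0 t1 t2 tm qn mq) rel =
    subst (λ q → Simulates (stepAt beattyMachine f q c) _) (sym (state≡ rel)) (simulate-query c t0 t1 t2 tm qn mq rel)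
  simulate-step c (aconf (ctl n) t0 t1 t2 tm qn mq) rel =
    subst (λ q → Simulates (stepAt beattyMachine f q c) _) (sym (state≡ rel))
      (subst (λ z → Simulates z _) (sym (stepAt-ordinary n c)) (simulate-ordinary n c t0 t1 t2 tm qn mq rel))

  simulate-run : ∀ k c a → Simulates c a → Simulates (run beattyMachine f k c) (runS k a)
  simulate-run zero c a rel = rel
  simulate-run (suc k) c a rel = simulate-run k (step beattyMachine f c) (stepS a) (simulate-step c a rel)

  initS : Word → AConfig
  initS x = aconf (ctl (scan (beforeProbe true) eq)) (fromWordS x) (tape [] blk []) (tape [] blk []) 0 0 0

  simulate-init : ∀ x → Simulates (initConfig beattyMachine x) (initS x)
  simulate-init x = record { state≡ = refl ; tapes≡ = tp ; time≡ = refl ; queries≡ = refl ; maxQuery≡ = refl }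
    where
      tp : ∀ i → tapes (initConfig beattyMachine x) i ≡ mapTape encodeSym (tapesS (initS x) i)
      tp zero = fromWord-encode x
      tp (suc zero) = refl
      tp (suc (suc zero)) = refl

-- Sweeps

-- Moving off an end of a tape adds a blank cell, so from the second round on the input is
-- flanked by single blanks.
data Margin : List Sym → Set where
  noMargin : Margin []
  oneBlank : Margin (blk ∷ [])

NonBlank : Sym → Set
NonBlank blk = ⊥
NonBlank _ = ⊤

IsFixed : Sym → Set
IsFixed (fixed _ _) = ⊤
IsFixed _ = ⊥

record ScanResult : Set where
  constructor scanResult
  field
    lft : List Sym
    md : Mode
    cm : Cmp
open ScanResult

scanCells : Mode → Cmp → List Sym → List Sym → ScanResult
scanCells m c l [] = scanResult l m c
scanCells m c l (x ∷ xs) = scanCells (proj₁ (proj₂ (scanCell m c x))) (proj₂ (proj₂ (scanCell m c x))) (proj₁ (scanCell m c x) ∷ l) xs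

δscan-nonBlank : ∀ m c x y z → NonBlank x → δscan m c x y z ≡
  act (ctl (scan (proj₁ (proj₂ (scanCell m c x))) (proj₂ (proj₂ (scanCell m c x))))) (proj₁ (scanCell m c x)) R y S z S
δscan-nonBlank (beforeProbe d) c (plain n) y z _ = refl
δscan-nonBlank (beforeProbe d) c (probe n) y z _ = refl
δscan-nonBlank (beforeProbe d) c (fixed n b) y z _ = refl
δscan-nonBlank afterProbe eq (plain n) y z _ = refl
δscan-nonBlank afterProbe eq (probe n) y z _ = refl
δscan-nonBlank afterProbe eq (fixed n b) y z _ = refl
δscan-nonBlank afterProbe lt (plain n) y z _ = refl
δscan-nonBlank afterProbe lt (probe n) y z _ = refl
δscan-nonBlank afterProbe lt (fixed n b) y z _ = refl
δscan-nonBlank afterProbe gt (plain n) y z _ = refl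
δscan-nonBlank afterProbe gt (probe n) y z _ = refl
δscan-nonBlank afterProbe gt (fixed n b) y z _ = refl

rewound : List Sym → Sym → List Sym → Tape Sym
rewound [] y rs = tape (blk ∷ []) y rs
rewound (z ∷ zs) y rs = rewound zs z (y ∷ rs)

queryAcc : List Sym → Sym → List Sym → List Sym
queryAcc [] y qs = plain (probeBit y) ∷ plain (inputBit y) ∷ qs
queryAcc (z ∷ zs) y qs = queryAcc zs z (plain (probeBit y) ∷ plain (inputBit y) ∷ qs)

copySteps : List Sym → ℕ
copySteps [] = 3
copySteps (_ ∷ zs) = suc (suc (copySteps zs))

rewindSteps : List Sym → ℕ
rewindSteps [] = 2
rewindSteps (_ ∷ zs) = suc (rewindSteps zs)

rewindState : Bool → Ctl
rewindState true = rewind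
rewindState false = rewindOut

afterRewind : Bool → Ctl
afterRewind true = scan (beforeProbe true) eq
afterRewind false = emit false

record EmitResult : Set where
  constructor emitResult
  field
    seen : Bool
    ol : List Sym
open EmitResult

emitCells : Bool → List Sym → List Sym → EmitResult
emitCells s o [] = emitResult s o
emitCells s o (fixed n b ∷ xs) = emitCells (s ∨ b) (if s ∨ b then plain b ∷ o else o) xs
emitCells s o (_ ∷ xs) = emitResult s o

outputTape : EmitResult → Tape Sym
outputTape (emitResult true o) = tape o blk []
outputTape (emitResult false o) = tape o (plain false) []

+-suc-suc : ∀ a b → a + suc (suc b) ≡ suc (suc (a + b))
+-suc-suc a b = trans (+-suc a (suc b)) (cong suc (+-suc a b))

moveR-margin : ∀ {r} → Margin r → ∀ l y → moveS R (tape l y r) ≡ tape (y ∷ l) blk []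
moveR-margin noMargin l y = refl
moveR-margin oneBlank l y = refl

module Sweeps (f : Word → Word) where
  open Run f

  run-scan : ∀ xs x m c l r t1 t2 tm qn mq → All NonBlank (x ∷ xs) → Margin r →
    runS (length (x ∷ xs)) (aconf (ctl (scan m c)) (tape l x (xs ++ r)) t1 t2 tm qn mq)
    ≡ aconf (ctl (scan (md (scanCells m c l (x ∷ xs))) (cm (scanCells m c l (x ∷ xs)))))
         (tape (lft (scanCells m c l (x ∷ xs))) blk []) t1 t2 (length (x ∷ xs) + tm) qn mq
  run-scan [] x m c l r t1 t2 tm qn mq (nb ∷ []) pad =
    trans (cong (λ o → applyAction o (aconf (ctl (scan m c)) (tape l x r) t1 t2 tm qn mq)) (δscan-nonBlank m c x _ _ nb))
          (cong (λ t → aconf _ t t1 t2 (suc tm) qn mq) (moveR-margin pad l _))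
  run-scan (x2 ∷ xs) x m c l r t1 t2 tm qn mq (nb ∷ nbs) pad =
    trans (cong (λ o → runS (length (x2 ∷ xs)) (applyAction o (aconf (ctl (scan m c)) (tape l x (x2 ∷ xs ++ r)) t1 t2 tm qn mq)))
                (δscan-nonBlank m c x _ _ nb))
    (trans (run-scan xs x2 _ _ _ r t1 t2 (suc tm) qn mq nbs pad)
      (cong (λ t → aconf (ctl (scan (md (scanCells m c l (x ∷ x2 ∷ xs))) (cm (scanCells m c l (x ∷ x2 ∷ xs)))))
         (tape (lft (scanCells m c l (x ∷ x2 ∷ xs))) blk []) t1 t2 t qn mq) (+-suc (length (x2 ∷ xs)) tm)))

  δcopyInput-nonBlank : ∀ y h z → NonBlank y → δctl copyInput y h z ≡ act (ctl copyProbe) y S (plain (inputBit y)) L z S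
  δcopyInput-nonBlank (plain _) h z _ = refl
  δcopyInput-nonBlank (probe _) h z _ = refl
  δcopyInput-nonBlank (fixed _ _) h z _ = refl

  run-copy : ∀ zs y l rs h qs t2 tm qn mq → NonBlank y → All NonBlank zs → Margin l →
    runS (copySteps zs) (aconf (ctl copyInput) (tape (zs ++ l) y rs) (tape [] h qs) t2 tm qn mq)
    ≡ aconf query (rewound zs y rs) (tape [] blk (queryAcc zs y qs)) t2 (copySteps zs + tm) qn mq
  run-copy [] y .[] rs h qs t2 tm qn mq nb [] noMargin =
    cong (λ o → runS 2 (applyAction o (aconf (ctl copyInput) (tape [] y rs) (tape [] h qs) t2 tm qn mq))) (δcopyInput-nonBlank y h _ nb)
  run-copy [] y .(blk ∷ []) rs h qs t2 tm qn mq nb [] oneBlank =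
    cong (λ o → runS 2 (applyAction o (aconf (ctl copyInput) (tape (blk ∷ []) y rs) (tape [] h qs) t2 tm qn mq))) (δcopyInput-nonBlank y h _ nb)
  run-copy (z ∷ zs) y l rs h qs t2 tm qn mq nb (nz ∷ nzs) pad =
    trans (cong (λ o → runS (copySteps zs) (stepS (applyAction o (aconf (ctl copyInput) (tape (z ∷ zs ++ l) y rs) (tape [] h qs) t2 tm qn mq))))
                (δcopyInput-nonBlank y h _ nb))
    (trans (run-copy zs z l (y ∷ rs) blk (plain (probeBit y) ∷ plain (inputBit y) ∷ qs) t2 (suc (suc tm)) qn mq nz nzs pad)
      (cong (λ t → aconf query (rewound (z ∷ zs) y rs) (tape [] blk (queryAcc (z ∷ zs) y qs)) t2 t qn mq) (+-suc-suc (copySteps zs) tm)))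

  δrewind-nonBlank : ∀ b y h z → NonBlank y → δctl (rewindState b) y h z ≡ act (ctl (rewindState b)) y L h S z S
  δrewind-nonBlank true (plain _) h z _ = refl
  δrewind-nonBlank true (probe _) h z _ = refl
  δrewind-nonBlank true (fixed _ _) h z _ = refl
  δrewind-nonBlank false (plain _) h z _ = refl
  δrewind-nonBlank false (probe _) h z _ = refl
  δrewind-nonBlank false (fixed _ _) h z _ = refl

  δrewind-blank : ∀ b h z → δctl (rewindState b) blk h z ≡ act (ctl (afterRewind b)) blk R h S z S
  δrewind-blank true h z = refl
  δrewind-blank false h z = refl

  run-rewind : ∀ b zs y l rs t1 t2 tm qn mq → NonBlank y → All NonBlank zs → Margin l →
    runS (rewindSteps zs) (aconf (ctl (rewindState b)) (tape (zs ++ l) y rs) t1 t2 tm qn mq)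
    ≡ aconf (ctl (afterRewind b)) (rewound zs y rs) t1 t2 (rewindSteps zs + tm) qn mq
  run-rewind b [] y .[] rs t1 t2 tm qn mq nb [] noMargin =
    trans (cong (λ o → runS 1 (applyAction o (aconf (ctl (rewindState b)) (tape [] y rs) t1 t2 tm qn mq))) (δrewind-nonBlank b y _ _ nb))
      (trans (cong (λ o → applyAction o (aconf (ctl (rewindState b)) (tape [] blk (y ∷ rs)) t1 t2 (suc tm) qn mq)) (δrewind-blank b (Tape.head t1) (Tape.head t2))) refl)
  run-rewind b [] y .(blk ∷ []) rs t1 t2 tm qn mq nb [] oneBlank =
    trans (cong (λ o → runS 1 (applyAction o (aconf (ctl (rewindState b)) (tape (blk ∷ []) y rs) t1 t2 tm qn mq))) (δrewind-nonBlank b y _ _ nb))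
      (trans (cong (λ o → applyAction o (aconf (ctl (rewindState b)) (tape [] blk (y ∷ rs)) t1 t2 (suc tm) qn mq)) (δrewind-blank b (Tape.head t1) (Tape.head t2))) refl)
  run-rewind b (z ∷ zs) y l rs t1 t2 tm qn mq nb (nz ∷ nzs) pad =
    trans (cong (λ o → runS (rewindSteps zs) (applyAction o (aconf (ctl (rewindState b)) (tape (z ∷ zs ++ l) y rs) t1 t2 tm qn mq)))
                (δrewind-nonBlank b y _ _ nb))
    (trans (run-rewind b zs z l (y ∷ rs) t1 t2 (suc tm) qn mq nz nzs pad)
      (cong (λ t → aconf (ctl (afterRewind b)) (rewound (z ∷ zs) y rs) t1 t2 t qn mq) (+-suc (rewindSteps zs) tm)))

  δemit-fixed : ∀ s n b y z → δctl (emit s) (fixed n b) y z ≡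
    act (ctl (emit (s ∨ b))) (fixed n b) R y S (if s ∨ b then plain b else z) (if s ∨ b then R else S)
  δemit-fixed false n false y z = refl
  δemit-fixed false n true y z = refl
  δemit-fixed true n b y z = refl

  emit-writes : ∀ s b o → moveS (if s ∨ b then R else S) (writeS (if s ∨ b then plain b else blk) (tape o blk []))
        ≡ tape (if s ∨ b then plain b ∷ o else o) blk []
  emit-writes false false o = refl
  emit-writes false true o = refl
  emit-writes true b o = refl

  run-emit : ∀ xs x s l r o t1 tm qn mq → All IsFixed (x ∷ xs) → Margin r →
    runS (length (x ∷ xs)) (aconf (ctl (emit s)) (tape l x (xs ++ r)) t1 (tape o blk []) tm qn mq)
    ≡ aconf (ctl (emit (seen (emitCells s o (x ∷ xs))))) (tape ((x ∷ xs) ʳ++ l) blk []) t1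
         (tape (ol (emitCells s o (x ∷ xs))) blk []) (length (x ∷ xs) + tm) qn mq
  run-emit [] (fixed n b) s l r o t1 tm qn mq (_ ∷ []) pad =
    trans (cong (λ q → applyAction q (aconf (ctl (emit s)) (tape l (fixed n b) r) t1 (tape o blk []) tm qn mq)) (δemit-fixed s n b _ _))
    (cong₂ (λ t u → aconf _ t t1 u (suc tm) qn mq) (moveR-margin pad l _) (emit-writes s b o))
  run-emit (x2 ∷ xs) (fixed n b) s l r o t1 tm qn mq (_ ∷ ds) pad =
    trans (cong (λ q → runS (length (x2 ∷ xs)) (applyAction q (aconf (ctl (emit s)) (tape l (fixed n b) (x2 ∷ xs ++ r)) t1 (tape o blk []) tm qn mq)))
                (δemit-fixed s n b _ _))
    (trans (cong (λ u → runS (length (x2 ∷ xs)) (aconf (ctl (emit (s ∨ b))) (tape (fixed n b ∷ l) x2 (xs ++ r)) t1 u (suc tm) qn mq))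
                 (emit-writes s b o))
    (trans (run-emit xs x2 (s ∨ b) (fixed n b ∷ l) r _ t1 (suc tm) qn mq ds pad)
      (cong (λ t → aconf (ctl (emit (seen (emitCells s o (fixed n b ∷ x2 ∷ xs))))) (tape ((fixed n b ∷ x2 ∷ xs) ʳ++ l) blk []) t1
         (tape (ol (emitCells s o (fixed n b ∷ x2 ∷ xs))) blk []) t qn mq) (+-suc (length (x2 ∷ xs)) tm))))

  run-halt : ∀ s lf o t1 tm qn mq →
    runS 1 (aconf (ctl (emit s)) (tape lf blk []) t1 (tape o blk []) tm qn mq)
    ≡ aconf halt (tape lf blk []) t1 (outputTape (emitResult s o)) (suc tm) qn mq
  run-halt false lf o t1 tm qn mq = refl
  run-halt true lf o t1 tm qn mq = refl

-- Tape layouts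

-- The input tape during the round that probes the candidate K10…0.
layout : List Bool → List Bool → List Sym
layout [] _ = []
layout (n ∷ ns) [] = probe n ∷ map plain ns
layout (n ∷ ns) (b ∷ bs) = fixed n b ∷ layout ns bs

candidate : List Bool → ℕ → List Bool
candidate K n = K ++ true ∷ replicate (n ∸ suc (length K)) false

modeAfter : Bool → List Bool → List Bool → Mode
modeAfter d [] [] = beforeProbe d
modeAfter d [] (_ ∷ _) = afterProbe
modeAfter d (_ ∷ K) [] = beforeProbe d
modeAfter d (_ ∷ K) (_ ∷ ns) = modeAfter d K ns

scan-plain : ∀ ns c l → scanCells afterProbe c l (map plain ns)
                         ≡ scanResult (map plain ns ʳ++ l) afterProbe (compareFrom c (replicate (length ns) false) ns)
scan-plain [] c l = refl
scan-plain (n ∷ ns) c l = scan-plain ns (cmpStep c false n) (plain n ∷ l)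

scan-first : ∀ ns d c l → scanCells (beforeProbe d) c l (map plain ns)
                           ≡ scanResult (layout ns [] ʳ++ l) (modeAfter d [] ns) (compareFrom c (candidate [] (length ns)) ns)
scan-first [] d c l = refl
scan-first (n ∷ ns) d c l = scan-plain ns (cmpStep c true n) (probe n ∷ l)

scan-layout : ∀ ns K₀ d c l → scanCells (beforeProbe d) c l (layout ns K₀) ≡
  scanResult (layout ns (K₀ ++ not d ∷ []) ʳ++ l) (modeAfter d (K₀ ++ not d ∷ []) ns)
             (compareFrom c (candidate (K₀ ++ not d ∷ []) (length ns)) ns)
scan-layout [] [] d c l = refl
scan-layout [] (_ ∷ _) d c l = refl
scan-layout (n ∷ ns) [] d c l = scan-first ns d (cmpStep c (not d) n) (fixed n (not d) ∷ l)
scan-layout (n ∷ ns) (b ∷ K₀) d c l = scan-layout ns K₀ d (cmpStep c b n) (fixed n b ∷ l)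

modeAfter-afterProbe : ∀ d K ns → length K < length ns → modeAfter d K ns ≡ afterProbe
modeAfter-afterProbe d [] (_ ∷ _) _ = refl
modeAfter-afterProbe d (_ ∷ K) (_ ∷ ns) (s≤s h) = modeAfter-afterProbe d K ns h

modeAfter-beforeProbe : ∀ d K ns → length K ≡ length ns → modeAfter d K ns ≡ beforeProbe d
modeAfter-beforeProbe d [] [] _ = refl
modeAfter-beforeProbe d (_ ∷ K) (_ ∷ ns) h = modeAfter-beforeProbe d K ns (suc-injective h)

plain-nonBlank : ∀ ns → All NonBlank (map plain ns)
plain-nonBlank [] = []
plain-nonBlank (n ∷ ns) = tt ∷ plain-nonBlank ns

layout-nonBlank : ∀ ns K → All NonBlank (layout ns K)
layout-nonBlank [] K = []
layout-nonBlank (n ∷ ns) [] = tt ∷ plain-nonBlank ns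
layout-nonBlank (n ∷ ns) (b ∷ K) = tt ∷ layout-nonBlank ns K

layout-fixed : ∀ ns K → length K ≡ length ns → All IsFixed (layout ns K)
layout-fixed [] K _ = []
layout-fixed (n ∷ ns) (b ∷ K) h = tt ∷ layout-fixed ns K (suc-injective h)

all-reverse : ∀ {A : Set} {P : A → Set} xs → All P xs → All P (reverse xs)
all-reverse [] [] = []
all-reverse (x ∷ xs) (p ∷ ps) = subst (All _) (sym (LP.unfold-reverse x xs)) (AllP.++⁺ (all-reverse xs ps) (p ∷ []))

length-layout : ∀ ns K → length (layout ns K) ≡ length ns
length-layout [] K = refl
length-layout (n ∷ ns) [] = cong suc (LP.length-map plain ns)
length-layout (n ∷ ns) (b ∷ K) = cong suc (length-layout ns K)

querySyms : List Sym → List Sym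
querySyms [] = []
querySyms (x ∷ xs) = plain (probeBit x) ∷ plain (inputBit x) ∷ querySyms xs

querySyms-++ : ∀ xs ys → querySyms (xs ++ ys) ≡ querySyms xs ++ querySyms ys
querySyms-++ [] ys = refl
querySyms-++ (x ∷ xs) ys = cong (λ z → plain (probeBit x) ∷ plain (inputBit x) ∷ z) (querySyms-++ xs ys)

queryAcc-defn : ∀ zs y qs → queryAcc zs y qs ≡ querySyms (reverse (y ∷ zs)) ++ qs
queryAcc-defn [] y qs = refl
queryAcc-defn (z ∷ zs) y qs = begin
    queryAcc zs z (plain (probeBit y) ∷ plain (inputBit y) ∷ qs)
  ≡⟨ queryAcc-defn zs z _ ⟩
    querySyms (reverse (z ∷ zs)) ++ querySyms (y ∷ []) ++ qs
  ≡⟨ sym (LP.++-assoc (querySyms (reverse (z ∷ zs))) (querySyms (y ∷ [])) qs) ⟩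
    (querySyms (reverse (z ∷ zs)) ++ querySyms (y ∷ [])) ++ qs
  ≡⟨ cong (_++ qs) (sym (querySyms-++ (reverse (z ∷ zs)) (y ∷ []))) ⟩
    querySyms (reverse (z ∷ zs) ++ y ∷ []) ++ qs
  ≡⟨ cong (λ w → querySyms w ++ qs) (sym (LP.unfold-reverse y (z ∷ zs))) ⟩
    querySyms (reverse (y ∷ z ∷ zs)) ++ qs ∎
  where open ≡-Reasoning

atLeftEnd : List Sym → Tape Sym
atLeftEnd [] = tape (blk ∷ []) blk []
atLeftEnd (x ∷ xs) = tape (blk ∷ []) x xs

rewound-defn : ∀ zs y rs → rewound zs y rs ≡ atLeftEnd (reverse (y ∷ zs) ++ rs)
rewound-defn [] y rs = refl
rewound-defn (z ∷ zs) y rs = begin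
    rewound zs z (y ∷ rs)
  ≡⟨ rewound-defn zs z (y ∷ rs) ⟩
    atLeftEnd (reverse (z ∷ zs) ++ y ∷ rs)
  ≡⟨ cong atLeftEnd (sym (LP.++-assoc (reverse (z ∷ zs)) (y ∷ []) rs)) ⟩
    atLeftEnd ((reverse (z ∷ zs) ++ y ∷ []) ++ rs)
  ≡⟨ cong (λ w → atLeftEnd (w ++ rs)) (sym (LP.unfold-reverse y (z ∷ zs))) ⟩
    atLeftEnd (reverse (y ∷ z ∷ zs) ++ rs) ∎
  where open ≡-Reasoning

takeBits-querySyms : ∀ xs → takeBitsS (querySyms xs) ≡ interleave (map probeBit xs) (map inputBit xs)
takeBits-querySyms [] = refl
takeBits-querySyms (x ∷ xs) = cong (λ z → probeBit x ∷ inputBit x ∷ z) (takeBits-querySyms xs)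

map-inputBit-layout : ∀ ns K → map inputBit (layout ns K) ≡ ns
map-inputBit-layout [] K = refl
map-inputBit-layout (n ∷ ns) [] = cong (n ∷_) (trans (sym (LP.map-∘ ns)) (LP.map-id ns))
map-inputBit-layout (n ∷ ns) (b ∷ K) = cong (n ∷_) (map-inputBit-layout ns K)

map-probeBit-layout : ∀ ns K → length K < length ns → map probeBit (layout ns K) ≡ candidate K (length ns)
map-probeBit-layout (n ∷ ns) [] _ = cong (true ∷_) (probeBits-plain ns)
  where
    probeBits-plain : ∀ ns → map probeBit (map plain ns) ≡ replicate (length ns) false
    probeBits-plain [] = refl
    probeBits-plain (x ∷ xs) = cong (false ∷_) (probeBits-plain xs)
map-probeBit-layout (n ∷ ns) (b ∷ K) (s≤s h) = cong (b ∷_) (map-probeBit-layout ns K h)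

length-candidate : ∀ K n → length K < n → length (candidate K n) ≡ n
length-candidate K n h = begin
    length (K ++ true ∷ replicate (n ∸ suc (length K)) false)
  ≡⟨ LP.length-++ K ⟩
    length K + suc (length (replicate (n ∸ suc (length K)) false))
  ≡⟨ cong (λ z → length K + suc z) (LP.length-replicate (n ∸ suc (length K))) ⟩
    length K + suc (n ∸ suc (length K))
  ≡⟨ +-suc (length K) _ ⟩
    suc (length K) + (n ∸ suc (length K))
  ≡⟨ m+[n∸m]≡n h ⟩
    n ∎
  where open ≡-Reasoning

takeBits-plain : ∀ bs r → takeBitsS (map plain bs ++ blk ∷ r) ≡ bs
takeBits-plain [] r = refl
takeBits-plain (b ∷ bs) r = cong (b ∷_) (takeBits-plain bs r)

emitCells-seen : ∀ ns K o → length K ≡ length ns → emitCells true o (layout ns K) ≡ emitResult true (map plain K ʳ++ o)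
emitCells-seen [] [] o _ = refl
emitCells-seen (n ∷ ns) (b ∷ K) o h = emitCells-seen ns K (plain b ∷ o) (suc-injective h)

wordS-emitted : ∀ bs → wordS (tape (map plain bs ʳ++ (plain true ∷ [])) blk []) ≡ true ∷ bs
wordS-emitted bs = begin
    takeBitsS (dropBlanksS (reverse (map plain bs ʳ++ (plain true ∷ [])) ++ blk ∷ []))
  ≡⟨ cong (λ z → takeBitsS (dropBlanksS (reverse z ++ blk ∷ []))) (LP.ʳ++-defn (map plain bs)) ⟩
    takeBitsS (dropBlanksS (reverse (reverse (map plain bs) ++ plain true ∷ []) ++ blk ∷ []))
  ≡⟨ cong (λ z → takeBitsS (dropBlanksS (z ++ blk ∷ []))) (LP.reverse-++ (reverse (map plain bs)) (plain true ∷ [])) ⟩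
    takeBitsS (dropBlanksS ((plain true ∷ []) ++ reverse (reverse (map plain bs)) ++ blk ∷ []))
  ≡⟨ cong (λ z → takeBitsS (dropBlanksS (plain true ∷ z ++ blk ∷ []))) (LP.reverse-involutive (map plain bs)) ⟩
    true ∷ takeBitsS (map plain bs ++ blk ∷ [])
  ≡⟨ cong (true ∷_) (takeBits-plain bs []) ⟩
    true ∷ bs ∎
  where open ≡-Reasoning

output-word : ∀ ns K → length K ≡ length ns → wordS (outputTape (emitCells false [] (layout ns K))) ≡ stripZeros K
output-word [] [] _ = refl
output-word (n ∷ ns) (false ∷ K) h = output-word ns K (suc-injective h)
output-word (n ∷ ns) (true ∷ K) h =
  trans (cong (λ z → wordS (outputTape z)) (emitCells-seen ns K (plain true ∷ []) (suc-injective h))) (wordS-emitted K)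

blankTape : Tape Sym
blankTape = tape [] blk []

dropBlanks-querySyms : ∀ xs → dropBlanksS (querySyms xs) ≡ querySyms xs
dropBlanks-querySyms [] = refl
dropBlanks-querySyms (x ∷ xs) = refl

copySteps-length : ∀ zs → copySteps zs ≡ 2 * length zs + 3
copySteps-length [] = refl
copySteps-length (z ∷ zs) = trans (cong (λ x → suc (suc x)) (copySteps-length zs))
  (solve 1 (λ n → con 1 :+ (con 1 :+ (con 2 :* n :+ con 3)) := con 2 :* (con 1 :+ n) :+ con 3) refl (length zs))

rewindSteps-length : ∀ zs → rewindSteps zs ≡ length zs + 2
rewindSteps-length [] = refl
rewindSteps-length (z ∷ zs) = cong suc (rewindSteps-length zs)

copyTime-bound : ∀ n t → suc (2 * n + 3 + suc t + 1) ≤ t + (4 * suc n + 4)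
copyTime-bound n t = m+n≤o⇒m≤o _ {2 * n + 2} (≤-reflexive
  (solve 2 (λ n t → con 1 :+ (con 2 :* n :+ con 3 :+ (con 1 :+ t) :+ con 1) :+ (con 2 :* n :+ con 2)
                  := t :+ (con 4 :* (con 1 :+ n) :+ con 4)) refl n t))

rewindTime-bound : ∀ n t → n + 2 + suc t ≤ t + (4 * suc n + 4)
rewindTime-bound n t = m+n≤o⇒m≤o _ {3 * n + 5} (≤-reflexive
  (solve 2 (λ n t → n :+ con 2 :+ (con 1 :+ t) :+ (con 3 :* n :+ con 5) := t :+ (con 4 :* (con 1 :+ n) :+ con 4)) refl n t))

lastRoundTime-bound : ∀ n t → suc (suc n + (n + 2 + suc (suc n + t))) ≤ t + (5 * suc n + 4)
lastRoundTime-bound n t = m+n≤o⇒m≤o _ {2 * n + 3} (≤-reflexive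
  (solve 2 (λ n t → con 1 :+ ((con 1 :+ n) :+ (n :+ con 2 :+ (con 1 :+ ((con 1 :+ n) :+ t)))) :+ (con 2 :* n :+ con 3)
                  := t :+ (con 5 :* (con 1 :+ n) :+ con 4)) refl n t))

cost-bound : ∀ ℓ X → 1 ≤ ℓ → ℓ ≤ X → suc ℓ * (5 * ℓ + 4) ≤ 20 * X ^ 2
cost-bound ℓ X 1≤ℓ ℓ≤X = begin
    suc ℓ * (5 * ℓ + 4)
  ≤⟨ *-mono-≤ (s≤s ℓ≤X) (+-monoˡ-≤ 4 (*-monoʳ-≤ 5 ℓ≤X)) ⟩
    suc X * (5 * X + 4)
  ≤⟨ *-mono-≤ (+-monoˡ-≤ X 1≤X) (+-monoʳ-≤ (5 * X) (*-monoʳ-≤ 4 1≤X)) ⟩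
    (X + X) * (5 * X + 4 * X)
  ≡⟨ solve 1 (λ x → (x :+ x) :* (con 5 :* x :+ con 4 :* x) := con 18 :* (x :* (x :* con 1))) refl X ⟩
    18 * X ^ 2
  ≤⟨ *-monoˡ-≤ (X ^ 2) (m≤m+n 18 2) ⟩
    20 * X ^ 2 ∎
  where
    open ≤-Reasoning
    1≤X : 1 ≤ X
    1≤X = ≤-trans 1≤ℓ ℓ≤X

-- Rounds of the binary search

module Round (f : Word → Word) (D : ℚ → Bool) (cut : IrrationalCut01 D) (orc : IsOracleFor D f)
  (m : ℕ) (ws : List Bool) (hb : bin (suc m) ≡ true ∷ ws) where

  open Run f
  open Sweeps f

  ns : List Bool
  ns = true ∷ ws

  ℓ : ℕ
  ℓ = suc (length ws)

  logN : ℕ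
  logN = ⌈log₂ (suc m) ⌉

  val-ns : val ns ≡ suc m
  val-ns = trans (cong val (sym hb)) (val-bin (suc m))

  2^|ws|≤n : 2 ^ length ws ≤ suc m
  2^|ws|≤n = subst (2 ^ length ws ≤_) val-ns (begin
      2 ^ length ws
    ≤⟨ m≤m+n (2 ^ length ws) (val ws) ⟩
      2 ^ length ws + val ws
    ≡⟨ cong (_+ val ws) (sym (*-identityˡ (2 ^ length ws))) ⟩
      1 * 2 ^ length ws + val ws
    ≡⟨ sym (valAcc-split 1 ws) ⟩
      val ns ∎)
    where open ≤-Reasoning

  roundCost : ℕ
  roundCost = 5 * ℓ + 4

  ℓ≤1+logN : ℓ ≤ 1 + logN
  ℓ≤1+logN = s≤s (2^k≤n⇒k≤⌈log₂n⌉ (length ws) (suc m) 2^|ws|≤n)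

  Bracket : List Bool → Set
  Bracket K = D (ratio (val (K ++ replicate (ℓ ∸ length K) false)) m) ≡ false
            × D (ratio (suc (val (K ++ replicate (ℓ ∸ length K) true))) m) ≡ true

  bracket-[] : Bracket []
  bracket-[] = trans (cong (λ z → D (ratio z m)) (val-replicate-false ℓ)) (D-ratio-zero cut m)
             , D-ratio-≥ cut m _ (<⇒≤ (subst₂ _<_ val-ns 2^ℓ≡ (val<2^length ns)))
    where
      2^ℓ≡ : 2 ^ ℓ ≡ suc (val (replicate ℓ true))
      2^ℓ≡ = trans (sym (val-replicate-true ℓ)) (+-comm (val (replicate ℓ true)) 1)

  bracket-step : ∀ K d → length K < ℓ → Bracket K → D (ratio (val (candidate K ℓ)) m) ≡ d → Bracket (K ++ not d ∷ [])
  bracket-step K d hK (lo , hi) D≡d = subst (Bracket′ d) (sym rest≡) (extend d D≡d)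
    where
      r = ℓ ∸ suc (length K)
      rest≡ : ℓ ∸ length (K ++ not d ∷ []) ≡ r
      rest≡ = cong (ℓ ∸_) (length-snoc K (not d))
      suc-r : ℓ ∸ length K ≡ suc r
      suc-r = +-∸-assoc 1 (s≤s⁻¹ hK)
      Bracket′ : Bool → ℕ → Set
      Bracket′ d z = D (ratio (val ((K ++ not d ∷ []) ++ replicate z false)) m) ≡ false
                 × D (ratio (suc (val ((K ++ not d ∷ []) ++ replicate z true))) m) ≡ true
      snoc-++ : ∀ x (z : List Bool) → (K ++ x ∷ []) ++ z ≡ K ++ x ∷ z
      snoc-++ x z = LP.++-assoc K (x ∷ []) z
      extend : ∀ d → D (ratio (val (candidate K ℓ)) m) ≡ d → Bracket′ d r
      extend false D≡d = subst (λ z → D (ratio (val z) m) ≡ false) (sym (snoc-++ true _)) D≡d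
                       , subst (λ z → D (ratio (suc (val z)) m) ≡ true) (sym (snoc-++ true _))
                           (subst (λ z → D (ratio (suc (val (K ++ replicate z true))) m) ≡ true) suc-r hi)
      extend true D≡d = subst (λ z → D (ratio (val z) m) ≡ false) (sym (snoc-++ false _))
                          (subst (λ z → D (ratio (val (K ++ replicate z false)) m) ≡ false) suc-r lo)
                      , subst (λ z → D (ratio (suc (val z)) m) ≡ true) (sym (snoc-++ false _))
                          (subst (λ z → D (ratio z m) ≡ true) (trans (sym (val-carry K r)) (+-comm _ 1)) D≡d)

  bracket⇒IsBeatty : ∀ K → length K ≡ ℓ → Bracket K → IsBeatty D m (val K)
  bracket⇒IsBeatty K hK (lo , hi) =
    subst (λ z → D (ratio (val z) m) ≡ false) (no-rest false) lo , subst (λ z → D (ratio (suc (val z)) m) ≡ true) (no-rest true) hi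
    where
      no-rest : ∀ x → K ++ replicate (ℓ ∸ length K) x ≡ K
      no-rest x = trans (cong (λ z → K ++ replicate z x) (trans (cong (ℓ ∸_) hK) (n∸n≡0 ℓ))) (LP.++-identityʳ K)

  -- Before the first round the budget may be exceeded by one: ℓ = logN + 1 when n is a power of two.
  QueryBudget : ℕ → ℕ → Set
  QueryBudget p qn = (p ≡ 0 × qn ≡ 0) ⊎ (qn + (ℓ ∸ p) ≤ logN)

  QueriesAfter : List Bool → ℕ → ℕ → Set
  QueriesAfter K qn qn′ = qn′ ≡ qn ⊎ (qn′ ≡ suc qn × val (candidate K ℓ) < suc m)

  queryBudget-step : ∀ K qn qn′ → length K < ℓ → QueryBudget (length K) qn → QueriesAfter K qn qn′ →
                     QueryBudget (suc (length K)) qn′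
  queryBudget-step K qn qn′ hK (inj₂ budget) queried = inj₂ (begin
      qn′ + (ℓ ∸ suc (length K))
    ≤⟨ +-monoˡ-≤ (ℓ ∸ suc (length K)) (at-most-one queried) ⟩
      suc qn + (ℓ ∸ suc (length K))
    ≡⟨ sym (+-suc qn _) ⟩
      qn + suc (ℓ ∸ suc (length K))
    ≡⟨ cong (qn +_) (sym (+-∸-assoc 1 (s≤s⁻¹ hK))) ⟩
      qn + (ℓ ∸ length K)
    ≤⟨ budget ⟩
      logN ∎)
    where
      open ≤-Reasoning
      at-most-one : QueriesAfter K qn qn′ → qn′ ≤ suc qn
      at-most-one (inj₁ refl) = n≤1+n qn
      at-most-one (inj₂ (refl , _)) = ≤-refl
  queryBudget-step [] .0 .0 _ (inj₁ (refl , refl)) (inj₁ refl) =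
    inj₂ (2^k≤n⇒k≤⌈log₂n⌉ (length ws) (suc m) 2^|ws|≤n)
  queryBudget-step [] .0 .1 _ (inj₁ (refl , refl)) (inj₂ (refl , c<n)) =
    inj₂ (2^k<n⇒k<⌈log₂n⌉ (length ws) (suc m) (subst (_< suc m) (val-true∷replicate-false (length ws)) c<n))

  queryBudget-done : ∀ qn → QueryBudget ℓ qn → qn ≤ logN
  queryBudget-done qn (inj₂ budget) = subst (_≤ logN) (trans (cong (qn +_) (n∸n≡0 ℓ)) (+-identityʳ qn)) budget

  encQ-candidate : ∀ K → length K < ℓ → encQ (val (candidate K ℓ)) (suc m) ≡ interleave (candidate K ℓ) ns
  encQ-candidate K hK = go (candidate K ℓ) (length-candidate K ℓ hK)
    where
      go : ∀ cs → length cs ≡ ℓ → encQ (val cs) (suc m) ≡ interleave cs ns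
      go (c ∷ cs) e = subst (λ z → encQ (val (c ∷ cs)) (suc m) ≡ interleave (c ∷ cs) z) hb
                        (encQ-val c cs (suc m) (trans (cong length hb) (sym e)))

  length-query : ∀ K → length K < ℓ → length (interleave (candidate K ℓ) ns) ≡ 2 * ℓ
  length-query K hK = trans (length-interleave (candidate K ℓ) ns)
    (trans (cong (_+ ℓ) (length-candidate K ℓ hK)) (cong (ℓ +_) (sym (+-identityʳ ℓ))))

  -- The cells of layout ns K as seen from its right end, where every scan stops.
  record LayoutEnd (K : List Bool) : Set where
    field
      lastCell : Sym
      otherCells : List Sym
      reverse-layout : reverse (layout ns K) ≡ lastCell ∷ otherCells

  layoutEnd : ∀ K → LayoutEnd K
  layoutEnd K with reverse (layout ns K) in e
  ... | [] = ⊥-elim (0≢1+n (trans (sym (cong length e)) (trans (LP.length-reverse (layout ns K)) (length-layout ns K))))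
  ... | y ∷ zs = record { lastCell = y ; otherCells = zs ; reverse-layout = e }

  module _ {K : List Bool} (v : LayoutEnd K) where
    open LayoutEnd v

    layout-ʳ++ : ∀ lp → layout ns K ʳ++ lp ≡ lastCell ∷ otherCells ++ lp
    layout-ʳ++ lp = trans (LP.ʳ++-defn (layout ns K)) (cong (_++ lp) reverse-layout)

    reverse-lastCell∷otherCells : reverse (lastCell ∷ otherCells) ≡ layout ns K
    reverse-lastCell∷otherCells = trans (cong reverse (sym reverse-layout)) (LP.reverse-involutive (layout ns K))

    length-otherCells : length otherCells ≡ length ws
    length-otherCells = suc-injective (trans (cong length (sym reverse-layout))
                          (trans (LP.length-reverse (layout ns K)) (length-layout ns K)))

    layoutEnd-nonBlank : NonBlank lastCell × All NonBlank otherCells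
    layoutEnd-nonBlank with subst (All NonBlank) reverse-layout (all-reverse (layout ns K) (layout-nonBlank ns K))
    ... | p ∷ ps = p , ps

    rewound-layout : rewound otherCells lastCell (blk ∷ []) ≡ atLeftEnd (layout ns K ++ blk ∷ [])
    rewound-layout = trans (rewound-defn otherCells lastCell (blk ∷ []))
                       (cong (λ z → atLeftEnd (z ++ blk ∷ [])) reverse-lastCell∷otherCells)

    queryWord : length K < ℓ → wordS (tape [] blk (queryAcc otherCells lastCell [])) ≡ interleave (candidate K ℓ) ns
    queryWord hK = begin
        takeBitsS (dropBlanksS (queryAcc otherCells lastCell []))
      ≡⟨ cong (λ z → takeBitsS (dropBlanksS z)) (queryAcc-defn otherCells lastCell []) ⟩
        takeBitsS (dropBlanksS (querySyms (reverse (lastCell ∷ otherCells)) ++ []))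
      ≡⟨ cong (λ z → takeBitsS (dropBlanksS z))
           (trans (LP.++-identityʳ _) (cong querySyms reverse-lastCell∷otherCells)) ⟩
        takeBitsS (dropBlanksS (querySyms (layout ns K)))
      ≡⟨ cong takeBitsS (dropBlanks-querySyms (layout ns K)) ⟩
        takeBitsS (querySyms (layout ns K))
      ≡⟨ takeBits-querySyms (layout ns K) ⟩
        interleave (map probeBit (layout ns K)) (map inputBit (layout ns K))
      ≡⟨ cong₂ interleave (map-probeBit-layout ns K hK) (map-inputBit-layout ns K) ⟩
        interleave (candidate K ℓ) ns ∎
      where open ≡-Reasoning

  open LayoutEnd

  run-query : ∀ T0 T1 T2 tm qn mq d → f (wordS T1) ≡ d ∷ [] →
    runS 2 (aconf query T0 T1 T2 tm qn mq)
    ≡ aconf (ctl (scan (beforeProbe d) eq)) T0 (tape [] (plain d) []) T2 (suc (tm + 1)) (suc qn) (mq ⊔ length (wordS T1))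
  run-query T0 T1 T2 tm qn mq d e = answered (f (wordS T1)) e
    where
      answered : ∀ r → r ≡ d ∷ [] →
        stepS (aconf (ctl answer) T0 (fromWordS r) T2 (tm + length r) (suc qn) (mq ⊔ length (wordS T1)))
        ≡ aconf (ctl (scan (beforeProbe d) eq)) T0 (tape [] (plain d) []) T2 (suc (tm + 1)) (suc qn) (mq ⊔ length (wordS T1))
      answered .(d ∷ []) refl = refl

  run-copyQuery : ∀ {K} (v : LayoutEnd K) lp h tm qn mq d → Margin lp →
    let y = lastCell v ; zs = otherCells v ; T1 = tape [] blk (queryAcc zs y []) in
    f (wordS T1) ≡ d ∷ [] →
    runS (suc (copySteps zs) + 2) (aconf (ctl (scan afterProbe lt)) (tape (y ∷ zs ++ lp) blk []) (tape [] h []) blankTape tm qn mq)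
    ≡ aconf (ctl (scan (beforeProbe d) eq)) (atLeftEnd (layout ns K ++ blk ∷ [])) (tape [] (plain d) []) blankTape
        (suc (copySteps zs + suc tm + 1)) (suc qn) (mq ⊔ length (wordS T1))
  run-copyQuery {K} v lp h tm qn mq d margin answer≡ = begin
      runS (suc (copySteps zs) + 2) A
    ≡⟨ runS-+ (suc (copySteps zs)) 2 A ⟩
      runS 2 (runS (copySteps zs) (aconf (ctl copyInput) (tape (zs ++ lp) y (blk ∷ [])) (tape [] h []) blankTape (suc tm) qn mq))
    ≡⟨ cong (runS 2) (run-copy zs y lp (blk ∷ []) h [] blankTape (suc tm) qn mq
                        (proj₁ (layoutEnd-nonBlank v)) (proj₂ (layoutEnd-nonBlank v)) margin) ⟩
      runS 2 (aconf query (rewound zs y (blk ∷ [])) T1 blankTape (copySteps zs + suc tm) qn mq)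
    ≡⟨ run-query (rewound zs y (blk ∷ [])) T1 blankTape (copySteps zs + suc tm) qn mq d answer≡ ⟩
      aconf (ctl (scan (beforeProbe d) eq)) (rewound zs y (blk ∷ [])) (tape [] (plain d) []) blankTape
        (suc (copySteps zs + suc tm + 1)) (suc qn) (mq ⊔ length (wordS T1))
    ≡⟨ cong (λ t → aconf (ctl (scan (beforeProbe d) eq)) t (tape [] (plain d) []) blankTape
                     (suc (copySteps zs + suc tm + 1)) (suc qn) (mq ⊔ length (wordS T1)))
         (rewound-layout v) ⟩
      aconf (ctl (scan (beforeProbe d) eq)) (atLeftEnd (layout ns K ++ blk ∷ [])) (tape [] (plain d) []) blankTape
        (suc (copySteps zs + suc tm + 1)) (suc qn) (mq ⊔ length (wordS T1)) ∎
    where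
      open ≡-Reasoning
      y = lastCell v
      zs = otherCells v
      T1 = tape [] blk (queryAcc zs y [])
      A = aconf (ctl (scan afterProbe lt)) (tape (y ∷ zs ++ lp) blk []) (tape [] h []) blankTape tm qn mq

  run-rewindToStart : ∀ {K} (v : LayoutEnd K) lp h tm qn mq c → Margin lp →
    δscan afterProbe c blk h blk ≡ act (ctl rewind) blk L h S blk S →
    let y = lastCell v ; zs = otherCells v in
    runS (suc (rewindSteps zs)) (aconf (ctl (scan afterProbe c)) (tape (y ∷ zs ++ lp) blk []) (tape [] h []) blankTape tm qn mq)
    ≡ aconf (ctl (scan (beforeProbe true) eq)) (atLeftEnd (layout ns K ++ blk ∷ [])) (tape [] h []) blankTape
        (rewindSteps zs + suc tm) qn mq
  run-rewindToStart {K} v lp h tm qn mq c margin rewinds = begin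
      runS (rewindSteps zs) (stepS A)
    ≡⟨ cong (λ o → runS (rewindSteps zs) (applyAction o A)) rewinds ⟩
      runS (rewindSteps zs) (aconf (ctl rewind) (tape (zs ++ lp) y (blk ∷ [])) (tape [] h []) blankTape (suc tm) qn mq)
    ≡⟨ run-rewind true zs y lp (blk ∷ []) (tape [] h []) blankTape (suc tm) qn mq
         (proj₁ (layoutEnd-nonBlank v)) (proj₂ (layoutEnd-nonBlank v)) margin ⟩
      aconf (ctl (scan (beforeProbe true) eq)) (rewound zs y (blk ∷ [])) (tape [] h []) blankTape (rewindSteps zs + suc tm) qn mq
    ≡⟨ cong (λ t → aconf (ctl (scan (beforeProbe true) eq)) t (tape [] h []) blankTape (rewindSteps zs + suc tm) qn mq)
         (rewound-layout v) ⟩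
      aconf (ctl (scan (beforeProbe true) eq)) (atLeftEnd (layout ns K ++ blk ∷ [])) (tape [] h []) blankTape
        (rewindSteps zs + suc tm) qn mq ∎
    where
      open ≡-Reasoning
      y = lastCell v
      zs = otherCells v
      A = aconf (ctl (scan afterProbe c)) (tape (y ∷ zs ++ lp) blk []) (tape [] h []) blankTape tm qn mq

  record RoundOutcome (K : List Bool) (tm qn mq cost : ℕ) (A : AConfig) : Set where
    field
      steps : ℕ
      d : Bool
      queryHead : Sym
      tm′ qn′ mq′ : ℕ
      run≡ : runS steps A ≡ aconf (ctl (scan (beforeProbe d) eq)) (atLeftEnd (layout ns K ++ blk ∷ []))
                                 (tape [] queryHead []) blankTape tm′ qn′ mq′
      D≡d : D (ratio (val (candidate K ℓ)) m) ≡ d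
      time≤ : tm′ ≤ tm + cost
      maxQuery≤ : mq′ ≤ mq ⊔ 2 * ℓ
      queried : QueriesAfter K qn qn′

  afterScan-query : ∀ K (v : LayoutEnd K) lp h tm qn mq → length K < ℓ → Margin lp →
    compareFrom eq (candidate K ℓ) ns ≡ lt →
    RoundOutcome K tm qn mq (4 * ℓ + 4)
      (aconf (ctl (scan afterProbe lt)) (tape (lastCell v ∷ otherCells v ++ lp) blk []) (tape [] h []) blankTape tm qn mq)
  afterScan-query K v lp h tm qn mq hK margin c<n = record
    { steps = suc (copySteps zs) + 2
    ; d = d
    ; queryHead = plain d
    ; tm′ = suc (copySteps zs + suc tm + 1)
    ; qn′ = suc qn
    ; mq′ = mq ⊔ length (wordS T1)
    ; run≡ = run-copyQuery v lp h tm qn mq d margin answer≡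
    ; D≡d = refl
    ; time≤ = subst (λ z → suc (z + suc tm + 1) ≤ tm + (4 * ℓ + 4))
                (sym (trans (copySteps-length zs) (cong (λ z → 2 * z + 3) (length-otherCells v))))
                (copyTime-bound (length ws) tm)
    ; maxQuery≤ = ⊔-monoʳ-≤ mq (≤-reflexive (trans (cong length query≡) (length-query K hK)))
    ; queried = inj₂ (refl , subst (val (candidate K ℓ) <_) val-ns
                               (compare-lt⇒< (candidate K ℓ) ns (length-candidate K ℓ hK) c<n)) }
    where
      y = lastCell v
      zs = otherCells v
      d = D (ratio (val (candidate K ℓ)) m)
      T1 = tape [] blk (queryAcc zs y [])
      query≡ : wordS T1 ≡ interleave (candidate K ℓ) ns
      query≡ = queryWord v hK
      answer≡ : f (wordS T1) ≡ d ∷ []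
      answer≡ = trans (cong f (trans query≡ (sym (encQ-candidate K hK)))) (orc (val (candidate K ℓ)) m)

  -- The hypothesis on δscan holds by computation for c = eq and c = gt; it lets one proof cover both.
  afterScan-noQuery : ∀ K (v : LayoutEnd K) lp h tm qn mq c → length K < ℓ → Margin lp →
    compareFrom eq (candidate K ℓ) ns ≡ c → (c ≡ lt → ⊥) →
    δscan afterProbe c blk h blk ≡ act (ctl rewind) blk L h S blk S →
    RoundOutcome K tm qn mq (4 * ℓ + 4)
      (aconf (ctl (scan afterProbe c)) (tape (lastCell v ∷ otherCells v ++ lp) blk []) (tape [] h []) blankTape tm qn mq)
  afterScan-noQuery K v lp h tm qn mq c hK margin c≡ c≢lt rewinds = record
    { steps = suc (rewindSteps zs)
    ; d = true
    ; queryHead = h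
    ; tm′ = rewindSteps zs + suc tm
    ; qn′ = qn
    ; mq′ = mq
    ; run≡ = run-rewindToStart v lp h tm qn mq c margin rewinds
    ; D≡d = D-ratio-≥ cut m (val (candidate K ℓ)) (subst (_≤ val (candidate K ℓ)) val-ns
              (compare-≢lt⇒≥ (candidate K ℓ) ns (length-candidate K ℓ hK) (λ e → c≢lt (trans (sym c≡) e))))
    ; time≤ = subst (λ z → z + suc tm ≤ tm + (4 * ℓ + 4))
                (sym (trans (rewindSteps-length zs) (cong (_+ 2) (length-otherCells v))))
                (rewindTime-bound (length ws) tm)
    ; maxQuery≤ = m≤m⊔n mq _
    ; queried = inj₁ refl }
    where zs = otherCells v

  afterScan : ∀ K lp h tm qn mq → length K < ℓ → Margin lp →
    RoundOutcome K tm qn mq (4 * ℓ + 4)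
      (aconf (ctl (scan afterProbe (compareFrom eq (candidate K ℓ) ns))) (tape (layout ns K ʳ++ lp) blk []) (tape [] h []) blankTape tm qn mq)
  afterScan K lp h tm qn mq hK margin =
    subst (λ t → RoundOutcome K tm qn mq (4 * ℓ + 4)
                   (aconf (ctl (scan afterProbe (compareFrom eq (candidate K ℓ) ns))) (tape t blk []) (tape [] h []) blankTape tm qn mq))
      (sym (layout-ʳ++ v lp)) (byComparison (compareFrom eq (candidate K ℓ) ns) refl)
    where
      v = layoutEnd K
      byComparison : ∀ c → compareFrom eq (candidate K ℓ) ns ≡ c →
        RoundOutcome K tm qn mq (4 * ℓ + 4)
          (aconf (ctl (scan afterProbe c)) (tape (lastCell v ∷ otherCells v ++ lp) blk []) (tape [] h []) blankTape tm qn mq)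
      byComparison lt c≡ = afterScan-query K v lp h tm qn mq hK margin c≡
      byComparison eq c≡ = afterScan-noQuery K v lp h tm qn mq eq hK margin c≡ (λ ()) refl
      byComparison gt c≡ = afterScan-noQuery K v lp h tm qn mq gt hK margin c≡ (λ ()) refl

  -- The input cells at the start of a round, K having just been extended by the answer bit not d.
  RoundStart : List Bool → Bool → List Sym → Set
  RoundStart K d cells = (K ≡ [] × cells ≡ map plain ns)
                       ⊎ (Σ (List Bool) λ K₀ → K ≡ K₀ ++ not d ∷ [] × cells ≡ layout ns K₀)

  roundStart-scan : ∀ K d cells lp → RoundStart K d cells →
    scanCells (beforeProbe d) eq lp cells ≡ scanResult (layout ns K ʳ++ lp) (modeAfter d K ns) (compareFrom eq (candidate K ℓ) ns)
  roundStart-scan .[] d .(map plain ns) lp (inj₁ (refl , refl)) = scan-first ns d eq lp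
  roundStart-scan .(K₀ ++ not d ∷ []) d .(layout ns K₀) lp (inj₂ (K₀ , refl , refl)) = scan-layout ns K₀ d eq lp

  roundStart-length : ∀ K d cells → RoundStart K d cells → length cells ≡ ℓ
  roundStart-length .[] d .(map plain ns) (inj₁ (refl , refl)) = LP.length-map plain ns
  roundStart-length .(K₀ ++ not d ∷ []) d .(layout ns K₀) (inj₂ (K₀ , refl , refl)) = length-layout ns K₀

  roundStart-nonBlank : ∀ K d cells → RoundStart K d cells → All NonBlank cells
  roundStart-nonBlank .[] d .(map plain ns) (inj₁ (refl , refl)) = plain-nonBlank ns
  roundStart-nonBlank .(K₀ ++ not d ∷ []) d .(layout ns K₀) (inj₂ (K₀ , refl , refl)) = layout-nonBlank ns K₀

  run-roundScan : ∀ K d x xs lp rp h tm qn mq → RoundStart K d (x ∷ xs) → Margin rp →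
    runS (length (x ∷ xs)) (aconf (ctl (scan (beforeProbe d) eq)) (tape lp x (xs ++ rp)) (tape [] h []) blankTape tm qn mq)
    ≡ aconf (ctl (scan (modeAfter d K ns) (compareFrom eq (candidate K ℓ) ns))) (tape (layout ns K ʳ++ lp) blk [])
        (tape [] h []) blankTape (length (x ∷ xs) + tm) qn mq
  run-roundScan K d x xs lp rp h tm qn mq start margin =
    trans (run-scan xs x (beforeProbe d) eq lp rp (tape [] h []) blankTape tm qn mq (roundStart-nonBlank K d (x ∷ xs) start) margin)
      (cong (λ r → aconf (ctl (scan (md r) (cm r))) (tape (lft r) blk []) (tape [] h []) blankTape (length (x ∷ xs) + tm) qn mq)
        (roundStart-scan K d (x ∷ xs) lp start))

  run-round : ∀ K d x xs lp rp h tm qn mq → RoundStart K d (x ∷ xs) → length K < ℓ → Margin lp → Margin rp →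
    RoundOutcome K tm qn mq roundCost
      (aconf (ctl (scan (beforeProbe d) eq)) (tape lp x (xs ++ rp)) (tape [] h []) blankTape tm qn mq)
  run-round K d x xs lp rp h tm qn mq start hK marginˡ marginʳ = record
    { steps = len + steps
    ; d = d′
    ; queryHead = queryHead
    ; tm′ = tm′
    ; qn′ = qn′
    ; mq′ = mq′
    ; run≡ = trans (runS-+ len steps A) (trans (cong (runS steps) scanned) run≡)
    ; D≡d = D≡d
    ; time≤ = ≤-trans time≤ (≤-reflexive cost≡)
    ; maxQuery≤ = maxQuery≤
    ; queried = queried }
    where
      len = length (x ∷ xs)
      A = aconf (ctl (scan (beforeProbe d) eq)) (tape lp x (xs ++ rp)) (tape [] h []) blankTape tm qn mq
      rest = afterScan K lp h (len + tm) qn mq hK marginˡ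
      open RoundOutcome rest renaming (d to d′)
      scanned : runS len A ≡ aconf (ctl (scan afterProbe (compareFrom eq (candidate K ℓ) ns))) (tape (layout ns K ʳ++ lp) blk [])
                                (tape [] h []) blankTape (len + tm) qn mq
      scanned = trans (run-roundScan K d x xs lp rp h tm qn mq start marginʳ)
                  (cong (λ md → aconf (ctl (scan md _)) (tape (layout ns K ʳ++ lp) blk []) (tape [] h []) blankTape (len + tm) qn mq)
                    (modeAfter-afterProbe d K ns hK))
      cost≡ : len + tm + (4 * ℓ + 4) ≡ tm + roundCost
      cost≡ = trans (cong (λ z → z + tm + (4 * ℓ + 4)) (roundStart-length K d (x ∷ xs) start))
                (solve 2 (λ l t → l :+ t :+ (con 4 :* l :+ con 4) := t :+ (con 5 :* l :+ con 4)) refl ℓ tm)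

  record LastRound (K : List Bool) (tm : ℕ) (h : Sym) (qn mq : ℕ) (A : AConfig) : Set where
    field
      steps : ℕ
      inputTape : Tape Sym
      tm′ : ℕ
      run≡ : runS steps A ≡ aconf halt inputTape (tape [] h []) (outputTape (emitCells false [] (layout ns K))) tm′ qn mq
      time≤ : tm′ ≤ tm + roundCost

  run-output : ∀ b K₁ h tm qn mq → length (b ∷ K₁) ≡ ℓ →
    let K = b ∷ K₁ in
    runS (length (layout ns K) + 1)
      (aconf (ctl (emit false)) (tape (blk ∷ []) (fixed true b) (layout ws K₁ ++ blk ∷ [])) (tape [] h []) blankTape tm qn mq)
    ≡ aconf halt (tape (layout ns K ʳ++ (blk ∷ [])) blk []) (tape [] h []) (outputTape (emitCells false [] (layout ns K)))
        (suc (length (layout ns K) + tm)) qn mq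
  run-output b K₁ h tm qn mq hK =
    trans (runS-+ (length (layout ns K)) 1 A)
      (trans (cong (runS 1) (run-emit (layout ws K₁) (fixed true b) false (blk ∷ []) (blk ∷ []) [] (tape [] h []) tm qn mq
                               (layout-fixed ns K hK) oneBlank))
        (run-halt (seen emitted) (layout ns K ʳ++ (blk ∷ [])) (ol emitted) (tape [] h []) (length (layout ns K) + tm) qn mq))
    where
      K = b ∷ K₁
      A = aconf (ctl (emit false)) (tape (blk ∷ []) (fixed true b) (layout ws K₁ ++ blk ∷ [])) (tape [] h []) blankTape tm qn mq
      emitted = emitCells false [] (layout ns K)

  run-lastRound : ∀ K d x xs lp rp h tm qn mq → RoundStart K d (x ∷ xs) → length K ≡ ℓ → Margin lp → Margin rp →
    LastRound K tm h qn mq (aconf (ctl (scan (beforeProbe d) eq)) (tape lp x (xs ++ rp)) (tape [] h []) blankTape tm qn mq)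
  run-lastRound [] d x xs lp rp h tm qn mq start () marginˡ marginʳ
  run-lastRound K@(b ∷ K₁) d x xs lp rp h tm qn mq start hK marginˡ marginʳ = record
    { steps = len + (suc (rewindSteps zs) + (len₂ + 1))
    ; inputTape = tape (layout ns K ʳ++ (blk ∷ [])) blk []
    ; tm′ = suc (len₂ + tmR)
    ; run≡ = run≡
    ; time≤ = time≤ }
    where
      v = layoutEnd K
      y = lastCell v
      zs = otherCells v
      len = length (x ∷ xs)
      len₂ = length (layout ns K)
      c = compareFrom eq (candidate K ℓ) ns
      tmR = rewindSteps zs + suc (len + tm)
      A = aconf (ctl (scan (beforeProbe d) eq)) (tape lp x (xs ++ rp)) (tape [] h []) blankTape tm qn mq
      A₁ = aconf (ctl (scan (beforeProbe d) c)) (tape (y ∷ zs ++ lp) blk []) (tape [] h []) blankTape (len + tm) qn mq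
      A₂ = aconf (ctl (emit false)) (tape (blk ∷ []) (fixed true b) (layout ws K₁ ++ blk ∷ [])) (tape [] h []) blankTape tmR qn mq
      scanned : runS len A ≡ A₁
      scanned = trans (run-roundScan K d x xs lp rp h tm qn mq start marginʳ)
                  (cong₂ (λ md t → aconf (ctl (scan md c)) (tape t blk []) (tape [] h []) blankTape (len + tm) qn mq)
                    (modeAfter-beforeProbe d K ns hK) (layout-ʳ++ v lp))
      rewound≡ : runS (suc (rewindSteps zs)) A₁ ≡ A₂
      rewound≡ = trans (run-rewind false zs y lp (blk ∷ []) (tape [] h []) blankTape (suc (len + tm)) qn mq
                          (proj₁ (layoutEnd-nonBlank v)) (proj₂ (layoutEnd-nonBlank v)) marginˡ)
                   (cong (λ t → aconf (ctl (emit false)) t (tape [] h []) blankTape tmR qn mq) (rewound-layout v))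
      run≡ = begin
          runS (len + (suc (rewindSteps zs) + (len₂ + 1))) A
        ≡⟨ runS-+ len _ A ⟩
          runS (suc (rewindSteps zs) + (len₂ + 1)) (runS len A)
        ≡⟨ cong (runS (suc (rewindSteps zs) + (len₂ + 1))) scanned ⟩
          runS (suc (rewindSteps zs) + (len₂ + 1)) A₁
        ≡⟨ runS-+ (suc (rewindSteps zs)) (len₂ + 1) A₁ ⟩
          runS (len₂ + 1) (runS (suc (rewindSteps zs)) A₁)
        ≡⟨ cong (runS (len₂ + 1)) rewound≡ ⟩
          runS (len₂ + 1) A₂
        ≡⟨ run-output b K₁ h tmR qn mq hK ⟩
          aconf halt (tape (layout ns K ʳ++ (blk ∷ [])) blk []) (tape [] h []) (outputTape (emitCells false [] (layout ns K)))
            (suc (len₂ + tmR)) qn mq ∎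
        where open ≡-Reasoning
      time≤ : suc (len₂ + tmR) ≤ tm + roundCost
      time≤ = subst (_≤ tm + roundCost)
                (sym (cong₃ (λ a r e → suc (a + (r + suc (e + tm))))
                  (length-layout ns K) (trans (rewindSteps-length zs) (cong (_+ 2) (length-otherCells v)))
                  (roundStart-length K d (x ∷ xs) start)))
                (lastRoundTime-bound (length ws) tm)

  record Completion (A : AConfig) : Set where
    field
      steps : ℕ
      T0 T1 T2 : Tape Sym
      tm′ qn′ mq′ b : ℕ
      run≡ : runS steps A ≡ aconf halt T0 T1 T2 tm′ qn′ mq′
      output≡ : wordS T2 ≡ bin b
      beatty : IsBeatty D m b
      time≤ : tm′ ≤ suc ℓ * roundCost
      queries≤ : qn′ ≤ logN
      maxQuery≤ : mq′ ≤ 2 * ℓ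

  completion-after : ∀ {A A′} k → runS k A ≡ A′ → Completion A′ → Completion A
  completion-after {A} k A→A′ c = record
    { steps = k + steps ; T0 = T0 ; T1 = T1 ; T2 = T2 ; tm′ = tm′ ; qn′ = qn′ ; mq′ = mq′ ; b = b
    ; run≡ = trans (runS-+ k steps A) (trans (cong (runS steps) A→A′) run≡)
    ; output≡ = output≡ ; beatty = beatty ; time≤ = time≤ ; queries≤ = queries≤ ; maxQuery≤ = maxQuery≤ }
    where open Completion c

  run-rounds : ∀ r K d x xs lp rp h tm qn mq → length K + r ≡ ℓ → RoundStart K d (x ∷ xs) → Margin lp → Margin rp →
    Bracket K → QueryBudget (length K) qn → tm ≤ length K * roundCost → mq ≤ 2 * ℓ →
    Completion (aconf (ctl (scan (beforeProbe d) eq)) (tape lp x (xs ++ rp)) (tape [] h []) blankTape tm qn mq)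
  run-rounds zero K d x xs lp rp h tm qn mq K+0≡ start marginˡ marginʳ bracket budget tm≤ mq≤ = record
    { steps = steps
    ; T0 = inputTape
    ; T1 = tape [] h []
    ; T2 = outputTape (emitCells false [] (layout ns K))
    ; tm′ = tm′ ; qn′ = qn ; mq′ = mq ; b = val K
    ; run≡ = run≡
    ; output≡ = trans (output-word ns K hK) (sym (bin-val K))
    ; beatty = bracket⇒IsBeatty K hK bracket
    ; time≤ = ≤-trans time≤ (≤-trans (+-monoˡ-≤ roundCost tm≤)
               (≤-reflexive (trans (cong (λ z → z * roundCost + roundCost) hK) (+-comm (ℓ * roundCost) roundCost))))
    ; queries≤ = queryBudget-done qn (subst (λ p → QueryBudget p qn) hK budget)
    ; maxQuery≤ = mq≤ }
    where
      hK : length K ≡ ℓ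
      hK = trans (sym (+-identityʳ (length K))) K+0≡
      open LastRound (run-lastRound K d x xs lp rp h tm qn mq start hK marginˡ marginʳ)
  run-rounds (suc r) K d x xs lp rp h tm qn mq K+r≡ start marginˡ marginʳ bracket budget tm≤ mq≤ =
    continue (layout ns K) refl
    where
      hK : length K < ℓ
      hK = subst (length K <_) K+r≡ (m<m+n (length K) (s≤s z≤n))
      A = aconf (ctl (scan (beforeProbe d) eq)) (tape lp x (xs ++ rp)) (tape [] h []) blankTape tm qn mq
      round = run-round K d x xs lp rp h tm qn mq start hK marginˡ marginʳ
      open RoundOutcome round using (queryHead; D≡d; queried)
        renaming (d to d′; steps to roundSteps; run≡ to round≡; time≤ to roundTime≤)
      K′ = K ++ not d′ ∷ []
      length-K′ = length-snoc K (not d′)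
      continue : ∀ cells → layout ns K ≡ cells → Completion A
      continue [] e = ⊥-elim (0≢1+n (trans (cong length (sym e)) (length-layout ns K)))
      continue (x′ ∷ xs′) e = completion-after roundSteps
        (trans round≡ (cong (λ z → aconf (ctl (scan (beforeProbe d′) eq)) (atLeftEnd (z ++ blk ∷ [])) (tape [] queryHead []) blankTape
                                        (RoundOutcome.tm′ round) (RoundOutcome.qn′ round) (RoundOutcome.mq′ round)) e))
        (run-rounds r K′ d′ x′ xs′ (blk ∷ []) (blk ∷ []) queryHead
          (RoundOutcome.tm′ round) (RoundOutcome.qn′ round) (RoundOutcome.mq′ round)
          (trans (cong (_+ r) length-K′) (trans (sym (+-suc (length K) r)) K+r≡))
          (inj₂ (K , refl , sym e)) oneBlank oneBlank
          (bracket-step K d′ hK bracket D≡d)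
          (subst (λ p → QueryBudget p (RoundOutcome.qn′ round)) (sym length-K′)
            (queryBudget-step K qn (RoundOutcome.qn′ round) hK budget queried))
          (≤-trans roundTime≤ (≤-trans (+-monoˡ-≤ roundCost tm≤)
            (≤-reflexive (trans (+-comm (length K * roundCost) roundCost) (cong (_* roundCost) (sym length-K′))))))
          (≤-trans (RoundOutcome.maxQuery≤ round) (⊔-lub mq≤ ≤-refl)))

  completion : Completion (initS (bin (suc m)))
  completion = subst Completion (cong (λ w → aconf (ctl (scan (beforeProbe true) eq)) (fromWordS w) blankTape blankTape 0 0 0) (sym hb))
    (subst (λ cells → Completion (aconf (ctl (scan (beforeProbe true) eq)) (tape [] (plain true) cells) blankTape blankTape 0 0 0))
      (LP.++-identityʳ (map plain ws))
      (run-rounds ℓ [] true (plain true) (map plain ws) [] [] blk 0 0 0 refl (inj₁ (refl , refl)) noMargin noMargin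
        bracket-[] (inj₁ (refl , refl)) z≤n z≤n))

module Execution {D : ℚ → Bool} (cut : IrrationalCut01 D) (f : Word → Word) (orc : IsOracleFor D f) (m : ℕ) where
  open Round f D cut orc m (proj₁ (bin-suc-leading-one m)) (proj₂ (bin-suc-leading-one m))
  open Run f
  open Completion completion public using (steps; b; beatty)
  open Completion completion using (T2; run≡; output≡; time≤; queries≤; maxQuery≤)

  final : Config beattyMachine
  final = run beattyMachine f steps (initConfig beattyMachine (bin (suc m)))

  sim : Simulates final (runS steps (initS (bin (suc m))))
  sim = simulate-run steps (initConfig beattyMachine (bin (suc m))) (initS (bin (suc m))) (simulate-init (bin (suc m)))

  open Simulates (subst (Simulates final) run≡ sim)

  halted : Halted beattyMachine final
  halted = state≡

  output≡bin : output beattyMachine final ≡ bin b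
  output≡bin = trans (cong (word beattyMachine) (tapes≡ (suc (suc zero)))) (trans (word-encode T2) output≡)

  time-bound : time final ≤ 20 * (1 + logN) ^ 2
  time-bound = subst (_≤ 20 * (1 + logN) ^ 2) (sym time≡) (≤-trans time≤ (cost-bound ℓ (1 + logN) (s≤s z≤n) ℓ≤1+logN))

  queries-bound : queries final ≤ logN
  queries-bound = subst (_≤ logN) (sym queries≡) queries≤

  maxQuery-bound : maxQuery final ≤ 2 * (1 + logN)
  maxQuery-bound = subst (_≤ 2 * (1 + logN)) (sym maxQuery≡) (≤-trans maxQuery≤ (*-monoʳ-≤ 2 ℓ≤1+logN))

mainTheorem18 : (D : ℚ → Bool) → IrrationalCut01 D →
    Σ OTM λ M → Σ ℕ λ a → Σ ℕ λ d → Σ ℕ λ c →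
    (f : Word → Word) → IsOracleFor D f →
    (m : ℕ) → Σ ℕ λ fuel →
    Halted M (run M f fuel (initConfig M (bin (suc m))))
    × Σ ℕ (λ b → IsBeatty D m b × output M (run M f fuel (initConfig M (bin (suc m)))) ≡ bin b)
    × time (run M f fuel (initConfig M (bin (suc m)))) ≤ a * (1 + ⌈log₂ (suc m) ⌉) ^ d
    × queries (run M f fuel (initConfig M (bin (suc m)))) ≤ ⌈log₂ (suc m) ⌉
    × maxQuery (run M f fuel (initConfig M (bin (suc m)))) ≤ c * (1 + ⌈log₂ (suc m) ⌉)
mainTheorem18 D cut = beattyMachine , 20 , 2 , 2 , λ f orc m →
  let open Execution cut f orc m in
  steps , halted , (b , beatty , output≡bin) , time-bound , queries-bound , maxQuery-bound
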